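{- Let $\Phi$ be a consistent theory over RPL$\forall$ such that the term structure $\langle[0,1]_{\mathrm{RPL}},\mathbf{T}^{\Phi}\rangle$ associated to $\Phi$ is a model of $\Phi$. Then $\langle[0,1]_{\mathrm{RPL}},\mathbf{T}^{\Phi}\rangle$ is free on the class of all reduced models of $\Phi$; that is, for every reduced model $\langle[0,1]_{\mathrm{RPL}},\mathbf{N}\rangle$ of $\Phi$ and every $\mathbf{N}$-evaluation $v$, there is a unique homomorphism $g$ from $\langle[0,1]_{\mathrm{RPL}},\mathbf{T}^{\Phi}\rangle$ to $\langle[0,1]_{\mathrm{RPL}},\mathbf{N}\rangle$ such that $g(\overline{x})=v(x)$ for every variable $x$.
   Context: **Logic.** RPL$\forall$ (Rational Pavelka predicate logic) is first-order Łukasiewicz logic with a truth constant $\overline r$ for each rational $r\in[0,1]$. Conventions: $\neg\varphi:=\varphi\to\overline 0$, $\varphi\&\psi:=\neg(\varphi\to\neg\psi)$, $\varphi\leftrightarrow\psi:=(\varphi\to\psi)\&(\psi\to\varphi)$, $(\exists x)\varphi:=\neg(\forall x)\neg\varphi$. On $[0,1]$: $a\to b=\min\{1,1-a+b\}$ and $a\& b=\max\{0,a+b-1\}$. Every predicate language contains a binary predicate symbol $\approx$. Axioms: $\varphi\to(\psi\to\varphi)$; $(\varphi\to\psi)\to((\psi\to\xi)\to(\varphi\to\xi))$; $(\neg\psi\to\neg\varphi)\to(\psi\to\varphi)$ [with instances of the contrapositive form]; $((\varphi\to\psi)\to\psi)\to((\psi\to\varphi)\to\varphi)$; $(\overline r\to\overline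 s)\leftrightarrow\overline{r\to s}$; $(\overline r\&\overline s)\leftrightarrow\overline{r\& s}$; $(\forall x)\varphi(x)\to\varphi(t)$ for $t$ substitutable for $x$ in $\varphi$; $(\forall x)(\xi\to\varphi)\to(\xi\to(\forall x)\varphi)$ for $x$ not free in $\xi$; and the similarity and congruence axioms: (S1) $(\forall x)\,x\approx x$; (S2) $(\forall x)(\forall y)(x\approx y\to y\approx x)$; (S3) $(\forall x)(\forall y)(\forall z)(x\approx y\& y\approx z\to x\approx z)$; (C1) for each $n$-ary function symbol $F$, the universal closure of $x_1\approx y_1\&\cdots\& x_n\approx y_n\to F(x_1,\dots,x_n)\approx F(y_1,\dots,y_n)$; (C2) for each $n$-ary predicate symbol $P$, the universal closure of $x_1\approx y_1\&\cdots\& x_n\approx y_n\to(P(x_1,\dots,x_n)\leftrightarrow P(y_1,\dots,y_n))$. Rules: Modus Ponens and Generalization (from $\varphi$ infer $(\forall x)\varphi$). $\vdash$ denotes provability in this system. A theory is a set of sentences; $\Phi$ is consistent if $\Phi\not\vdash\overline 0$. **Semantics.** A structure $\langle[0,1]_{\mathrm{RPL}},\mathbf M\rangle$ consists of a non-empty domain $M$, a function $P_{\mathbf M}:M^n\to[0,1]$ for each $n$-ary predicate symbol $P$, and a function $F_{\mathbf M}:M^n\to M$ for each $n$-ary function symbol $F$ (constants are $0$-ary function symbols). An $\mathbf M$-evaluation $v$ maps variables to $M$. Values $\|t\|_{\mathbf M,v}\in M$ of terms and truth values $\|\varphi\|_{\mathbf M,v}\in[0,1]$ of formulas are defined recursively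 as usual, with $\overline r$ having value $r$, connectives interpreted by the operations above on the standard real interval $[0,1]$, $\forall$ by infimum and $\exists$ by supremum over $M$. Put $\|\varphi\|_{\mathbf M}=\inf_v\|\varphi\|_{\mathbf M,v}$. A model of $\Phi$ is a structure with $\|\varphi\|_{\mathbf M}=1$ for all $\varphi\in\Phi$, where the axioms S1–S3, C1, C2 are also required to have value $1$. A structure is reduced if its Leibniz congruence is the identity, equivalently if for all $d,e\in M$: $\approx_{\mathbf M}(d,e)=1$ iff $d=e$. **Homomorphism.** A map $g:M\to N$ is a homomorphism from $\langle[0,1]_{\mathrm{RPL}},\mathbf M\rangle$ to $\langle[0,1]_{\mathrm{RPL}},\mathbf N\rangle$ if for all $n$-ary function symbols $F$, $n$-ary predicate symbols $P$ and $d_1,\dots,d_n\in M$: (1) $g(F_{\mathbf M}(d_1,\dots,d_n))=F_{\mathbf N}(g(d_1),\dots,g(d_n))$; (2) $P_{\mathbf M}(d_1,\dots,d_n)=1$ implies $P_{\mathbf N}(g(d_1),\dots,g(d_n))=1$. **Term structure.** The provability degree is $|\varphi|_\Phi=\sup\{r\in[0,1]\cap\mathbb Q\mid\Phi\vdash\overline r\to\varphi\}$. For terms (possibly containing variables), $t_1\sim t_2$ iff $|t_1\approx t_2|_\Phi=1$; this is an equivalence relation and $\overline t$ denotes the class of $t$. The term structure associated to $\Phi$ has domain $T^\Phi$ the set of all $\sim$-classes of terms, with $F_{\mathbf T^\Phi}(\overline{t_1},\dots,\overline{t_n})=\overline{F(t_1,\dots,t_n)}$ and $P_{\mathbf T^\Phi}(\overline{t_1},\dots,\overline{t_n})=|P(t_1,\dots,t_n)|_\Phi$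 (these are well defined). -}

module Defs where

open import Data.Empty using (⊥-elim)
open import Data.Nat as ℕ using (ℕ; zero; suc)
import Data.Nat.Properties as ℕ
open import Data.Product using (Σ; ∃; _×_; _,_; proj₁; proj₂)
import Data.Rational as ℚ
open ℚ using (ℚ; 0ℚ; 1ℚ)
import Data.Rational.Properties as ℚ
open import Data.Rational.Solver using (module +-*-Solver)
open import Data.Vec as Vec using (Vec; []; _∷_; _++_)
open import Data.Vec.Properties using (++-injective; map-++; ∷-injectiveˡ; ∷-injectiveʳ)
open import Data.Vec.Relation.Binary.Pointwise.Inductive using (Pointwise; []; _∷_)
open import Data.Vec.Relation.Unary.All as All using (All; []; _∷_)
open import Data.Vec.Relation.Unary.Any using (Any; here; there)
open import Data.Vec.Relation.Unary.Unique.Propositional using (Unique; []; _∷_)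
open import Function using (_∘_)
open import Function.Bundles using (Func)
open import Level using (Level; Lift; lift; lower) renaming (_⊔_ to _⊔ˡ_; suc to sucˡ)
open import Relation.Binary using (Setoid)
open import Relation.Binary.PropositionalEquality
  using (_≡_; _≢_; refl; sym; trans; cong; cong₂; subst)
open import Relation.Nullary using (¬_; yes; no)
open import Relation.Nullary.Decidable using (decidable-stable)

private
  variable
    ℓ ℓ₁ ℓ₂ : Level
    m n : ℕ

lin< : ∀ {a b p q} → a ℚ.< b → p ℚ.+ b ≡ q ℚ.+ a → p ℚ.< q
lin< {a} {b} {p} {q} a<b eq = ℚ.≰⇒> λ q≤p →
  ℚ.<-irrefl (sym eq) (ℚ.+-mono-≤-< q≤p a<b)

lin≤¹ : ∀ {a b p q} → a ℚ.≤ b → p ℚ.+ b ≡ q ℚ.+ a → p ℚ.≤ q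
lin≤¹ {a} {b} {p} {q} a≤b eq = ℚ.≮⇒≥ λ q<p →
  ℚ.<-irrefl (sym eq) (ℚ.+-mono-<-≤ q<p a≤b)

lin≤ : ∀ {a b c d p q} → a ℚ.≤ b → c ℚ.≤ d →
       p ℚ.+ (b ℚ.+ d) ≡ q ℚ.+ (a ℚ.+ c) → p ℚ.≤ q
lin≤ {a} {b} {c} {d} {p} {q} a≤b c≤d eq = ℚ.≮⇒≥ λ q<p →
  ℚ.<-irrefl (sym eq) (ℚ.+-mono-<-≤ q<p (ℚ.+-mono-≤ a≤b c≤d))

0≤1 : 0ℚ ℚ.≤ 1ℚ
0≤1 = ℚ.<⇒≤ (ℚ.positive⁻¹ 1ℚ)

record ℚ₀₁ : Set where
  constructor mk₀₁
  field
    value : ℚ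
    0≤value : 0ℚ ℚ.≤ value
    value≤1 : value ℚ.≤ 1ℚ
open ℚ₀₁ public

0₀₁ 1₀₁ : ℚ₀₁
0₀₁ = mk₀₁ 0ℚ ℚ.≤-refl 0≤1
1₀₁ = mk₀₁ 1ℚ 0≤1 ℚ.≤-refl

_⇒₀₁_ : ℚ₀₁ → ℚ₀₁ → ℚ₀₁
mk₀₁ r 0≤r r≤1 ⇒₀₁ mk₀₁ s 0≤s s≤1 = mk₀₁ (1ℚ ℚ.⊓ t)
  (ℚ.⊓-glb {0ℚ} {1ℚ} {t} 0≤1 (lin≤ r≤1 0≤s
    (solve 2 (λ r s → con 0ℚ :+ (con 1ℚ :+ s) :=
                      con 1ℚ :- r :+ s :+ (r :+ con 0ℚ)) refl r s)))
  (ℚ.p⊓q≤p 1ℚ t)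
  where
    open +-*-Solver
    t = 1ℚ ℚ.- r ℚ.+ s

_&₀₁_ : ℚ₀₁ → ℚ₀₁ → ℚ₀₁
mk₀₁ r 0≤r r≤1 &₀₁ mk₀₁ s 0≤s s≤1 = mk₀₁ (0ℚ ℚ.⊔ t)
  (ℚ.p≤p⊔q 0ℚ t)
  (ℚ.⊔-lub {1ℚ} {0ℚ} {t} 0≤1 (lin≤ r≤1 s≤1
    (solve 2 (λ r s → r :+ s :- con 1ℚ :+ (con 1ℚ :+ con 1ℚ) :=
                      con 1ℚ :+ (r :+ s)) refl r s)))
  where
    open +-*-Solver
    t = r ℚ.+ s ℚ.- 1ℚ

-- A real x is given by the set of all rationals q ≤ x.  Requiring this set
-- to be ¬¬-stable yields the reals of classical mathematics rather than the
-- located reals of constructive analysis: under excluded middle `stable` is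
-- vacuous, and without it bounded suprema and infima still exist.

record ℝ (ℓ : Level) : Set (sucˡ ℓ) where
  field
    cut       : ℚ → Set ℓ
    down      : ∀ {p q} → p ℚ.≤ q → cut q → cut p
    closed    : ∀ {q} → (∀ p → p ℚ.< q → cut p) → cut q
    stable    : ∀ {q} → ¬ ¬ cut q → cut q
    inhabited : ∃ cut
    bounded   : ∃ λ u → ∀ q → cut q → q ℚ.≤ u
open ℝ public

infix 4 _≤_ _≃_ _≃ᴵ_

_≤_ : ℝ ℓ₁ → ℝ ℓ₂ → Set (ℓ₁ ⊔ˡ ℓ₂)
x ≤ y = ∀ {q} → cut x q → cut y q

_≃_ : ℝ ℓ₁ → ℝ ℓ₂ → Set (ℓ₁ ⊔ˡ ℓ₂)
x ≃ y = x ≤ y × y ≤ x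

rat : ℚ → ℝ ℓ
rat {ℓ} r = record
  { cut       = λ q → Lift ℓ (q ℚ.≤ r)
  ; down      = λ p≤q q≤r → lift (ℚ.≤-trans p≤q (lower q≤r))
  ; closed    = λ below → lift (ℚ.≮⇒≥ λ r<q → case-dense r<q below)
  ; stable    = λ ¬¬q≤r → lift (decidable-stable (_ ℚ.≤? r) λ q≰r →
                                 ¬¬q≤r (q≰r ∘ lower))
  ; inhabited = r , lift ℚ.≤-refl
  ; bounded   = r , λ _ → lower
  }
  where
    case-dense : ∀ {q} → r ℚ.< q → ¬ (∀ p → p ℚ.< q → Lift ℓ (p ℚ.≤ r))
    case-dense r<q below with ℚ.<-dense r<q
    ... | m , r<m , m<q = ℚ.<-irrefl refl (ℚ.<-≤-trans r<m (lower (below m m<q)))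

infixl 6 _-_ _+_
infixl 7 _⊓_

-- q ≤ x - y iff q + s ≤ x for every rational s ≤ y.
_-_ : ℝ ℓ → ℝ ℓ → ℝ ℓ
x - y = record
  { cut       = λ q → ∀ s → cut y s → cut x (q ℚ.+ s)
  ; down      = λ p≤q h s s∈y → down x (ℚ.+-monoˡ-≤ s p≤q) (h s s∈y)
  ; closed    = λ {q} below s s∈y → closed x λ p p<q+s →
      subst (cut x)
        (solve 2 (λ p s → p :- s :+ s := p) refl p s)
        (below (p ℚ.- s)
          (lin< p<q+s (solve 3 (λ p q s → p :- s :+ (q :+ s) := q :+ p)
                               refl p q s))
          s s∈y)
  ; stable    = λ ¬¬h s s∈y → stable x λ ¬c → ¬¬h λ h → ¬c (h s s∈y)
  ; inhabited = a ℚ.- u , λ s s∈y → down x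
      (lin≤¹ (≤u s s∈y)
        (solve 3 (λ a u s → a :- u :+ s :+ u := a :+ s) refl a u s)) a∈x
  ; bounded   = v ℚ.- b , λ q h → lin≤¹ (≤v (q ℚ.+ b) (h b b∈y))
        (solve 3 (λ q v b → q :+ v := v :- b :+ (q :+ b)) refl q v b)
  }
  where
    open +-*-Solver
    a = proj₁ (inhabited x)
    a∈x = proj₂ (inhabited x)
    b = proj₁ (inhabited y)
    b∈y = proj₂ (inhabited y)
    u = proj₁ (bounded y)
    ≤u = proj₂ (bounded y)
    v = proj₁ (bounded x)
    ≤v = proj₂ (bounded x)

_+_ : ℝ ℓ → ℝ ℓ → ℝ ℓ
x + y = x - (rat 0ℚ - y)

_⊓_ : ℝ ℓ → ℝ ℓ → ℝ ℓ
x ⊓ y = record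
  { cut       = λ q → cut x q × cut y q
  ; down      = λ p≤q (c , d) → down x p≤q c , down y p≤q d
  ; closed    = λ below → closed x (λ p p<q → proj₁ (below p p<q))
                        , closed y (λ p p<q → proj₂ (below p p<q))
  ; stable    = λ ¬¬h → stable x (λ ¬c → ¬¬h (¬c ∘ proj₁))
                      , stable y (λ ¬d → ¬¬h (¬d ∘ proj₂))
  ; inhabited = a ℚ.⊓ b , down x (ℚ.p⊓q≤p a b) (proj₂ (inhabited x))
                        , down y (ℚ.p⊓q≤q a b) (proj₂ (inhabited y))
  ; bounded   = proj₁ (bounded x) , λ q (c , _) → proj₂ (bounded x) q c
  }
  where
    a = proj₁ (inhabited x)
    b = proj₁ (inhabited y)

record 𝕀 (ℓ : Level) : Set (sucˡ ℓ) where
  constructor mkᴵ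
  field
    real   : ℝ ℓ
    0≤real : rat {ℓ} 0ℚ ≤ real
    real≤1 : real ≤ rat {ℓ} 1ℚ
open 𝕀 public

_≃ᴵ_ : 𝕀 ℓ₁ → 𝕀 ℓ₂ → Set (ℓ₁ ⊔ˡ ℓ₂)
a ≃ᴵ b = real a ≃ real b

ratᴵ : ℚ₀₁ → 𝕀 ℓ
ratᴵ r = mkᴵ (rat (value r))
  (λ q≤0 → lift (ℚ.≤-trans (lower q≤0) (0≤value r)))
  (λ q≤r → lift (ℚ.≤-trans (lower q≤r) (value≤1 r)))

1ᴵ : 𝕀 ℓ
1ᴵ = ratᴵ 1₀₁

_⇒ᴵ_ : 𝕀 ℓ → 𝕀 ℓ → 𝕀 ℓ
_⇒ᴵ_ {ℓ} a b = mkᴵ (rat 1ℚ ⊓ (rat 1ℚ - real a + real b))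
  (λ {q} q≤0 → lift (ℚ.≤-trans (lower q≤0) 0≤1) , λ s s≤-b u u∈a → lift
    (ℚ.≤-trans
      (ℚ.+-mono-≤
        (ℚ.+-mono-≤ (lower q≤0)
          (subst (ℚ._≤ 0ℚ) (ℚ.+-identityʳ s)
            (lower (s≤-b 0ℚ (0≤real b (lift ℚ.≤-refl))))))
        (lower (real≤1 a u∈a)))
      ℚ.≤-refl))
  proj₁

⨅ : {I : Set ℓ} → (I → 𝕀 ℓ) → 𝕀 ℓ
⨅ {ℓ} x = mkᴵ
  (record
    { cut       = λ q → cut (rat {ℓ} 1ℚ) q × (∀ i → cut (real (x i)) q)
    ; down      = λ p≤q (c , h) → down (rat 1ℚ) p≤q c
                                , λ i → down (real (x i)) p≤q (h i)
    ; closed    = λ below → closed (rat 1ℚ) (λ p p<q → proj₁ (below p p<q))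
                          , λ i → closed (real (x i)) λ p p<q → proj₂ (below p p<q) i
    ; stable    = λ ¬¬h → stable (rat 1ℚ) (λ ¬c → ¬¬h (¬c ∘ proj₁))
                        , λ i → stable (real (x i)) λ ¬c → ¬¬h λ h → ¬c (proj₂ h i)
    ; inhabited = 0ℚ , lift 0≤1 , λ i → 0≤real (x i) (lift ℚ.≤-refl)
    ; bounded   = 1ℚ , λ q h → lower (proj₁ h)
    })
  (λ q≤0 → lift (ℚ.≤-trans (lower q≤0) 0≤1) , λ i → 0≤real (x i) q≤0)
  proj₁

-- q ≤ sup x iff every rational 0 ≤ p < q satisfies p ≤ x i for some i;
-- the restriction to 0 ≤ p makes this the supremum within [0,1].
⨆ : {I : Set ℓ} → (I → 𝕀 ℓ) → 𝕀 ℓ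
⨆ {ℓ} {I} x = mkᴵ
  (record
    { cut       = C
    ; down      = λ p≤q h p p<q → h p (ℚ.<-≤-trans p<q p≤q)
    ; closed    = λ below p p<q 0≤p →
        let (m , p<m , m<q) = ℚ.<-dense p<q in below m m<q p p<m 0≤p
    ; stable    = λ ¬¬h p p<q 0≤p ¬e → ¬¬h λ h → h p p<q 0≤p ¬e
    ; inhabited = 0ℚ , λ p p<0 0≤p → ⊥-elim (ℚ.<-irrefl refl (ℚ.<-≤-trans p<0 0≤p))
    ; bounded   = 1ℚ , ≤1
    })
  (λ q≤0 p p<q 0≤p → ⊥-elim
    (ℚ.<-irrefl refl (ℚ.<-≤-trans p<q (ℚ.≤-trans (lower q≤0) 0≤p))))
  (λ {q} h → lift (≤1 q h))
  where
    C : ℚ → Set ℓ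
    C q = ∀ p → p ℚ.< q → 0ℚ ℚ.≤ p → ¬ ¬ (∃ λ i → cut (real (x i)) p)

    ≤1 : ∀ q → C q → q ℚ.≤ 1ℚ
    ≤1 q h = ℚ.≮⇒≥ λ 1<q →
      let (m , 1<m , m<q) = ℚ.<-dense 1<q in
      h m m<q (ℚ.≤-trans 0≤1 (ℚ.<⇒≤ 1<m)) λ (i , m∈) →
        ℚ.<-irrefl refl (ℚ.<-≤-trans 1<m (lower (real≤1 (x i) m∈)))

record Language (ℓ : Level) : Set (sucˡ ℓ) where
  field
    Fun : ℕ → Set ℓ
    Rel : ℕ → Set ℓ
    eq  : Rel 2
open Language public

private
  variable
    L : Language ℓ

data Term (L : Language ℓ) : Set ℓ where
  var : ℕ → Term L
  fun : Fun L n → Vec (Term L) n → Term L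

infixr 4 _⇒_
infix  4 _⇔_
infixr 5 _&_
infix  6 ~_ _≐_ _≐*_ ∀[_]_ ∃[_]_ ∀*[_]_

data Formula (L : Language ℓ) : Set ℓ where
  rel   : Rel L n → Vec (Term L) n → Formula L
  const : ℚ₀₁ → Formula L
  _⇒_   : Formula L → Formula L → Formula L
  ∀[_]_ : ℕ → Formula L → Formula L

~_ : Formula L → Formula L
~ φ = φ ⇒ const 0₀₁

_&_ _⇔_ : Formula L → Formula L → Formula L
φ & ψ = ~ (φ ⇒ ~ ψ)
φ ⇔ ψ = (φ ⇒ ψ) & (ψ ⇒ φ)

∃[_]_ : ℕ → Formula L → Formula L
∃[ x ] φ = ~ (∀[ x ] (~ φ))

_≐_ : Term L → Term L → Formula L
_≐_ {L = L} s t = rel (eq L) (s ∷ t ∷ [])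

data _∈ₜ_ {L : Language ℓ} (x : ℕ) : Term L → Set ℓ where
  var : x ∈ₜ var x
  fun : {F : Fun L n} {ts : Vec (Term L) n} → Any (x ∈ₜ_) ts → x ∈ₜ fun F ts

data _FreeIn_ {L : Language ℓ} (x : ℕ) : Formula L → Set ℓ where
  rel : {P : Rel L n} {ts : Vec (Term L) n} → Any (x ∈ₜ_) ts → x FreeIn rel P ts
  ⇒ˡ  : ∀ {φ ψ} → x FreeIn φ → x FreeIn (φ ⇒ ψ)
  ⇒ʳ  : ∀ {φ ψ} → x FreeIn ψ → x FreeIn (φ ⇒ ψ)
  all : ∀ {y φ} → x ≢ y → x FreeIn φ → x FreeIn (∀[ y ] φ)

Sentence : Formula L → Set _
Sentence φ = ∀ x → ¬ (x FreeIn φ)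

infix 8 _[_≔_]ᵗ _[_≔_]ᵛ _[_≔_]

mutual
  _[_≔_]ᵗ : Term L → ℕ → Term L → Term L
  var y    [ x ≔ t ]ᵗ with x ℕ.≟ y
  ... | yes _ = t
  ... | no  _ = var y
  fun F ts [ x ≔ t ]ᵗ = fun F (ts [ x ≔ t ]ᵛ)

  _[_≔_]ᵛ : Vec (Term L) n → ℕ → Term L → Vec (Term L) n
  []       [ x ≔ t ]ᵛ = []
  (s ∷ ts) [ x ≔ t ]ᵛ = s [ x ≔ t ]ᵗ ∷ ts [ x ≔ t ]ᵛ

_[_≔_] : Formula L → ℕ → Term L → Formula L
rel P ts   [ x ≔ t ] = rel P (ts [ x ≔ t ]ᵛ)
const r    [ x ≔ t ] = const r
(φ ⇒ ψ)    [ x ≔ t ] = φ [ x ≔ t ] ⇒ ψ [ x ≔ t ]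
(∀[ y ] φ) [ x ≔ t ] with x ℕ.≟ y
... | yes _ = ∀[ y ] φ
... | no  _ = ∀[ y ] φ [ x ≔ t ]

data Substitutable {L : Language ℓ} (t : Term L) (x : ℕ) : Formula L → Set ℓ where
  rel     : {P : Rel L n} {ts : Vec (Term L) n} → Substitutable t x (rel P ts)
  const   : ∀ {r} → Substitutable t x (const r)
  _⇒_     : ∀ {φ ψ} → Substitutable t x φ → Substitutable t x ψ →
            Substitutable t x (φ ⇒ ψ)
  notFree : ∀ {y φ} → ¬ (x FreeIn (∀[ y ] φ)) → Substitutable t x (∀[ y ] φ)
  all     : ∀ {y φ} → ¬ (y ∈ₜ t) → Substitutable t x φ → Substitutable t x (∀[ y ] φ)

∀*[_]_ : Vec ℕ n → Formula L → Formula L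
∀*[ []     ] φ = φ
∀*[ x ∷ xs ] φ = ∀[ x ] (∀*[ xs ] φ)

-- s₁ ≐ t₁ & … & sₙ ≐ tₙ; the empty conjunction is the truth constant 1.
_≐*_ : Vec (Term L) n → Vec (Term L) n → Formula L
[]           ≐* []           = const 1₀₁
(s ∷ [])     ≐* (t ∷ [])     = s ≐ t
(s ∷ r ∷ ss) ≐* (t ∷ u ∷ ts) = s ≐ t & (r ∷ ss) ≐* (u ∷ ts)

-- x, y, z, xs, ys are metavariables for pairwise distinct variables.
data SimilarityAxiom {L : Language ℓ} : Formula L → Set ℓ where
  S1 : ∀ x → SimilarityAxiom (∀[ x ] (var x ≐ var x))
  S2 : ∀ x y → Unique (x ∷ y ∷ []) →
       SimilarityAxiom (∀[ x ] ∀[ y ] (var x ≐ var y ⇒ var y ≐ var x))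
  S3 : ∀ x y z → Unique (x ∷ y ∷ z ∷ []) →
       SimilarityAxiom (∀[ x ] ∀[ y ] ∀[ z ]
         (var x ≐ var y & var y ≐ var z ⇒ var x ≐ var z))
  C1 : (F : Fun L n) (xs ys : Vec ℕ n) → Unique (xs ++ ys) →
       SimilarityAxiom (∀*[ xs ++ ys ]
         (Vec.map var xs ≐* Vec.map var ys ⇒
          fun F (Vec.map var xs) ≐ fun F (Vec.map var ys)))
  C2 : (P : Rel L n) (xs ys : Vec ℕ n) → Unique (xs ++ ys) →
       SimilarityAxiom (∀*[ xs ++ ys ]
         (Vec.map var xs ≐* Vec.map var ys ⇒
          (rel P (Vec.map var xs) ⇔ rel P (Vec.map var ys))))

data LogicalAxiom {L : Language ℓ} : Formula L → Set ℓ where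
  Ł1 : ∀ φ ψ → LogicalAxiom (φ ⇒ (ψ ⇒ φ))
  Ł2 : ∀ φ ψ ξ → LogicalAxiom ((φ ⇒ ψ) ⇒ ((ψ ⇒ ξ) ⇒ (φ ⇒ ξ)))
  Ł3 : ∀ φ ψ → LogicalAxiom ((~ φ ⇒ ~ ψ) ⇒ (ψ ⇒ φ))
  Ł4 : ∀ φ ψ → LogicalAxiom (((φ ⇒ ψ) ⇒ ψ) ⇒ ((ψ ⇒ φ) ⇒ φ))
  R⇒ : ∀ r s → LogicalAxiom ((const r ⇒ const s) ⇔ const (r ⇒₀₁ s))
  R& : ∀ r s → LogicalAxiom ((const r & const s) ⇔ const (r &₀₁ s))
  ∀1 : ∀ x φ t → Substitutable t x φ → LogicalAxiom (∀[ x ] φ ⇒ φ [ x ≔ t ])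
  ∀2 : ∀ x ξ φ → ¬ (x FreeIn ξ) →
       LogicalAxiom (∀[ x ] (ξ ⇒ φ) ⇒ (ξ ⇒ ∀[ x ] φ))
  similarity : ∀ {φ} → SimilarityAxiom φ → LogicalAxiom φ

record Theory (L : Language ℓ) : Set (sucˡ ℓ) where
  field
    Axiom     : Formula L → Set ℓ
    sentences : ∀ {φ} → Axiom φ → Sentence φ
open Theory public

infix 3 _⊢_

data _⊢_ {L : Language ℓ} (Φ : Theory L) : Formula L → Set ℓ where
  hyp   : ∀ {φ} → Axiom Φ φ → Φ ⊢ φ
  axiom : ∀ {φ} → LogicalAxiom φ → Φ ⊢ φ
  mp    : ∀ {φ ψ} → Φ ⊢ φ → Φ ⊢ φ ⇒ ψ → Φ ⊢ ψ
  gen   : ∀ {φ} x → Φ ⊢ φ → Φ ⊢ ∀[ x ] φ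

Consistent : Theory L → Set _
Consistent Φ = ¬ (Φ ⊢ const 0₀₁)

degree : {L : Language ℓ} → Theory L → Formula L → 𝕀 ℓ
degree Φ φ = ⨆ {I = Σ ℚ₀₁ λ r → Φ ⊢ const r ⇒ φ} (ratᴵ ∘ proj₁)

record Structure (L : Language ℓ₁) (ℓ : Level) : Set (ℓ₁ ⊔ˡ sucˡ ℓ) where
  field
    domain : Setoid ℓ ℓ
  open Setoid domain public using (Carrier; _≈_)
  field
    element  : Carrier
    funᴹ     : Fun L n → Vec Carrier n → Carrier
    funᴹ-cong : (F : Fun L n) {ds es : Vec Carrier n} → Pointwise _≈_ ds es →
               funᴹ F ds ≈ funᴹ F es
    relᴹ     : Rel L n → Vec Carrier n → 𝕀 ℓ
    relᴹ-cong : (P : Rel L n) {ds es : Vec Carrier n} → Pointwise _≈_ ds es →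
               relᴹ P ds ≃ᴵ relᴹ P es

  Evaluation : Set ℓ
  Evaluation = ℕ → Carrier

  _[_↦_] : Evaluation → ℕ → Carrier → Evaluation
  (v [ x ↦ d ]) y with x ℕ.≟ y
  ... | yes _ = d
  ... | no  _ = v y

  mutual
    ⟦_⟧ᵗ : Term L → Evaluation → Carrier
    ⟦ var x ⟧ᵗ    v = v x
    ⟦ fun F ts ⟧ᵗ v = funᴹ F (⟦ ts ⟧ᵛ v)

    ⟦_⟧ᵛ : Vec (Term L) n → Evaluation → Vec Carrier n
    ⟦ [] ⟧ᵛ     v = []
    ⟦ t ∷ ts ⟧ᵛ v = ⟦ t ⟧ᵗ v ∷ ⟦ ts ⟧ᵛ v

  ⟦_⟧ : Formula L → Evaluation → 𝕀 ℓ
  ⟦ rel P ts ⟧   v = relᴹ P (⟦ ts ⟧ᵛ v)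
  ⟦ const r ⟧    v = ratᴵ r
  ⟦ φ ⇒ ψ ⟧      v = ⟦ φ ⟧ v ⇒ᴵ ⟦ ψ ⟧ v
  ⟦ ∀[ x ] φ ⟧   v = ⨅ λ d → ⟦ φ ⟧ (v [ x ↦ d ])

  ‖_‖ : Formula L → 𝕀 ℓ
  ‖ φ ‖ = ⨅ ⟦ φ ⟧

record IsModel {L : Language ℓ₁} (M : Structure L ℓ) (Φ : Theory L) :
               Set (ℓ₁ ⊔ˡ ℓ) where
  open Structure M
  field
    ⊨theory     : ∀ {φ} → Axiom Φ φ → ‖ φ ‖ ≃ᴵ 1ᴵ {ℓ}
    ⊨similarity : ∀ {φ} → SimilarityAxiom φ → ‖ φ ‖ ≃ᴵ 1ᴵ {ℓ}

Reduced : {L : Language ℓ₁} → Structure L ℓ → Set ℓ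
Reduced {ℓ = ℓ} {L = L} M = ∀ d e →
  (relᴹ (eq L) (d ∷ e ∷ []) ≃ᴵ 1ᴵ {ℓ} → d ≈ e) ×
  (d ≈ e → relᴹ (eq L) (d ∷ e ∷ []) ≃ᴵ 1ᴵ {ℓ})
  where open Structure M

record Homomorphism {L : Language ℓ} (M : Structure L ℓ₁) (N : Structure L ℓ₂) :
                    Set (ℓ ⊔ˡ ℓ₁ ⊔ˡ ℓ₂) where
  private
    module M = Structure M
    module N = Structure N
  field
    map : Func M.domain N.domain
  open Func map public using (to; cong)
  field
    fun-homo : (F : Fun L n) (ds : Vec M.Carrier n) →
               to (M.funᴹ F ds) N.≈ N.funᴹ F (Vec.map to ds)
    rel-homo : (P : Rel L n) (ds : Vec M.Carrier n) →
               M.relᴹ P ds ≃ᴵ 1ᴵ {ℓ₁} → N.relᴹ P (Vec.map to ds) ≃ᴵ 1ᴵ {ℓ₂}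

_≈ʰ_ : {L : Language ℓ} {M : Structure L ℓ₁} {N : Structure L ℓ₂}
       (g h : Homomorphism M N) → Set (ℓ₁ ⊔ˡ ℓ₂)
_≈ʰ_ {M = M} {N} g h = ∀ (d : Structure.Carrier M) → to g d N.≈ to h d
  where
    open Homomorphism
    module N = Structure N

-- The operations of the term structure respect equality of provability
-- degree 1 between terms.
module Congruence {L : Language ℓ} (Φ : Theory L) where

  infix 3 ⊢_
  ⊢_ : Formula L → Set ℓ
  ⊢ φ = Φ ⊢ φ

  private
    variable
      φ ψ χ θ : Formula L

  hs : ⊢ φ ⇒ ψ → ⊢ ψ ⇒ χ → ⊢ φ ⇒ χ
  hs p q = mp q (mp p (axiom (Ł2 _ _ _)))

  weaken : ⊢ φ → ⊢ ψ ⇒ φ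
  weaken p = mp p (axiom (Ł1 _ _))

  assert : ⊢ φ ⇒ ((φ ⇒ ψ) ⇒ ψ)
  assert = hs (axiom (Ł1 _ _)) (axiom (Ł4 _ _))

  exchange : ⊢ (φ ⇒ (ψ ⇒ χ)) ⇒ (ψ ⇒ (φ ⇒ χ))
  exchange = hs (axiom (Ł2 _ _ _)) (mp assert (axiom (Ł2 _ _ _)))

  flip : ⊢ φ ⇒ (ψ ⇒ χ) → ⊢ ψ ⇒ (φ ⇒ χ)
  flip p = mp p exchange

  identity : ⊢ φ ⇒ φ
  identity {φ} =
    mp (axiom (Ł1 φ φ)) (flip (axiom (Ł1 φ (φ ⇒ (φ ⇒ φ)))))

  &-intro : ⊢ φ ⇒ (ψ ⇒ φ & ψ)
  &-intro = hs assert exchange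

  ¬¬-elim : ⊢ ~ ~ φ ⇒ φ
  ¬¬-elim = mp assert (axiom (Ł3 _ _))

  uncurry : ⊢ φ ⇒ (ψ ⇒ χ) → ⊢ φ & ψ ⇒ χ
  uncurry {φ} {ψ} {χ} p = hs (mp contra (axiom (Ł2 _ _ _))) ¬¬-elim
    where
      contra : ⊢ ~ χ ⇒ (φ ⇒ ~ ψ)
      contra = flip (hs p (axiom (Ł2 _ _ _)))

  &-fst : ⊢ φ & ψ ⇒ φ
  &-fst = uncurry (axiom (Ł1 _ _))

  &-snd : ⊢ φ & ψ ⇒ ψ
  &-snd = uncurry (weaken identity)

  data QF : Formula L → Set ℓ where
    rel   : (P : Rel L n) (ts : Vec (Term L) n) → QF (rel P ts)
    const : ∀ r → QF (const r)
    _⇒_   : QF φ → QF ψ → QF (φ ⇒ ψ)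

  _&ꟴ_ : QF φ → QF ψ → QF (φ & ψ)
  p &ꟴ q = (p ⇒ (q ⇒ const _)) ⇒ const _

  QF-≐* : (ts ss : Vec (Term L) n) → QF (ts ≐* ss)
  QF-≐* []           []           = const _
  QF-≐* (t ∷ [])     (s ∷ [])     = rel _ _
  QF-≐* (t ∷ u ∷ ts) (s ∷ r ∷ ss) = rel _ _ &ꟴ QF-≐* (u ∷ ts) (r ∷ ss)

  QF-subst : QF φ → ∀ x t → QF (φ [ x ≔ t ])
  QF-subst (rel P ts) x t = rel P _
  QF-subst (const r)  x t = const r
  QF-subst (p ⇒ q)    x t = QF-subst p x t ⇒ QF-subst q x t

  QF-substitutable : QF φ → ∀ t x → Substitutable t x φ
  QF-substitutable (rel P ts) t x = rel
  QF-substitutable (const r)  t x = const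
  QF-substitutable (p ⇒ q)    t x = QF-substitutable p t x ⇒ QF-substitutable q t x

  substsᵗ : Vec ℕ n → Vec (Term L) n → Term L → Term L
  substsᵗ []       []       t = t
  substsᵗ (z ∷ zs) (u ∷ us) t = substsᵗ zs us (t [ z ≔ u ]ᵗ)

  substsᵛ : Vec ℕ n → Vec (Term L) n → Vec (Term L) m → Vec (Term L) m
  substsᵛ []       []       ts = ts
  substsᵛ (z ∷ zs) (u ∷ us) ts = substsᵛ zs us (ts [ z ≔ u ]ᵛ)

  substs : Vec ℕ n → Vec (Term L) n → Formula L → Formula L
  substs []       []       φ = φ
  substs (z ∷ zs) (u ∷ us) φ = substs zs us (φ [ z ≔ u ])

  substsᵛ-[] : (zs : Vec ℕ n) (us : Vec (Term L) n) → substsᵛ zs us [] ≡ []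
  substsᵛ-[] []       []       = refl
  substsᵛ-[] (z ∷ zs) (u ∷ us) = substsᵛ-[] zs us

  substsᵛ-∷ : (zs : Vec ℕ n) (us : Vec (Term L) n) (t : Term L) (ts : Vec (Term L) m) →
              substsᵛ zs us (t ∷ ts) ≡ substsᵗ zs us t ∷ substsᵛ zs us ts
  substsᵛ-∷ []       []       t ts = refl
  substsᵛ-∷ (z ∷ zs) (u ∷ us) t ts = substsᵛ-∷ zs us _ _

  substsᵛ-++ : ∀ {k} (zs : Vec ℕ n) (us : Vec (Term L) n)
               (ts : Vec (Term L) m) (ss : Vec (Term L) k) →
               substsᵛ zs us (ts ++ ss) ≡ substsᵛ zs us ts ++ substsᵛ zs us ss
  substsᵛ-++ zs us []       ss rewrite substsᵛ-[] zs us = refl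
  substsᵛ-++ zs us (t ∷ ts) ss
    rewrite substsᵛ-∷ zs us t (ts ++ ss) | substsᵛ-∷ zs us t ts =
    cong (substsᵗ zs us t ∷_) (substsᵛ-++ zs us ts ss)

  substsᵗ-fun : (zs : Vec ℕ n) (us : Vec (Term L) n) (F : Fun L m) (ts : Vec (Term L) m) →
                substsᵗ zs us (fun F ts) ≡ fun F (substsᵛ zs us ts)
  substsᵗ-fun []       []       F ts = refl
  substsᵗ-fun (z ∷ zs) (u ∷ us) F ts = substsᵗ-fun zs us F _

  substs-rel : (zs : Vec ℕ n) (us : Vec (Term L) n) (P : Rel L m) (ts : Vec (Term L) m) →
               substs zs us (rel P ts) ≡ rel P (substsᵛ zs us ts)
  substs-rel []       []       P ts = refl
  substs-rel (z ∷ zs) (u ∷ us) P ts = substs-rel zs us P _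

  substs-const : (zs : Vec ℕ n) (us : Vec (Term L) n) (r : ℚ₀₁) →
                 substs zs us (const r) ≡ const r
  substs-const []       []       r = refl
  substs-const (z ∷ zs) (u ∷ us) r = substs-const zs us r

  substs-⇒ : (zs : Vec ℕ n) (us : Vec (Term L) n) (φ ψ : Formula L) →
             substs zs us (φ ⇒ ψ) ≡ (substs zs us φ ⇒ substs zs us ψ)
  substs-⇒ []       []       φ ψ = refl
  substs-⇒ (z ∷ zs) (u ∷ us) φ ψ = substs-⇒ zs us _ _

  substs-& : (zs : Vec ℕ n) (us : Vec (Term L) n) (φ ψ : Formula L) →
             substs zs us (φ & ψ) ≡ (substs zs us φ & substs zs us ψ)
  substs-& zs us φ ψ
    rewrite substs-⇒ zs us (φ ⇒ ~ ψ) (const 0₀₁)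
          | substs-⇒ zs us φ (~ ψ)
          | substs-⇒ zs us ψ (const 0₀₁)
          | substs-const zs us 0₀₁ = refl

  substs-≐ : (zs : Vec ℕ n) (us : Vec (Term L) n) (t s : Term L) →
             substs zs us (t ≐ s) ≡ (substsᵗ zs us t ≐ substsᵗ zs us s)
  substs-≐ zs us t s
    rewrite substs-rel zs us (eq L) (t ∷ s ∷ [])
          | substsᵛ-∷ zs us t (s ∷ [])
          | substsᵛ-∷ zs us s []
          | substsᵛ-[] zs us = refl

  substs-≐* : (zs : Vec ℕ n) (us : Vec (Term L) n) (ts ss : Vec (Term L) m) →
              substs zs us (ts ≐* ss) ≡ (substsᵛ zs us ts ≐* substsᵛ zs us ss)
  substs-≐* zs us [] []
    rewrite substsᵛ-[] zs us = substs-const zs us _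
  substs-≐* zs us (t ∷ []) (s ∷ [])
    rewrite substsᵛ-∷ zs us t [] | substsᵛ-∷ zs us s [] | substsᵛ-[] zs us =
    substs-≐ zs us t s
  substs-≐* zs us (t ∷ t₁ ∷ ts) (s ∷ s₁ ∷ ss) =
    trans (trans (substs-& zs us (t ≐ s) ((t₁ ∷ ts) ≐* (s₁ ∷ ss)))
                 (cong₂ _&_ (substs-≐ zs us t s)
                            (substs-≐* zs us (t₁ ∷ ts) (s₁ ∷ ss))))
          (sym unfold)
    where
      unfold : (substsᵛ zs us (t ∷ t₁ ∷ ts) ≐* substsᵛ zs us (s ∷ s₁ ∷ ss)) ≡
               (substsᵗ zs us t ≐ substsᵗ zs us s &
                substsᵛ zs us (t₁ ∷ ts) ≐* substsᵛ zs us (s₁ ∷ ss))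
      unfold
        rewrite substsᵛ-∷ zs us t (t₁ ∷ ts) | substsᵛ-∷ zs us s (s₁ ∷ ss)
              | substsᵛ-∷ zs us t₁ ts | substsᵛ-∷ zs us s₁ ss = refl

  mutual
    fresh-substᵗ : ∀ {x u} (t : Term L) → ¬ (x ∈ₜ t) → t [ x ≔ u ]ᵗ ≡ t
    fresh-substᵗ {x} (var y) x∉ with x ℕ.≟ y
    ... | yes refl = ⊥-elim (x∉ var)
    ... | no  _    = refl
    fresh-substᵗ (fun F ts) x∉ = cong (fun F) (fresh-substᵛ ts (x∉ ∘ fun))

    fresh-substᵛ : ∀ {x u} (ts : Vec (Term L) n) → ¬ Any (x ∈ₜ_) ts → ts [ x ≔ u ]ᵛ ≡ ts
    fresh-substᵛ []       x∉ = refl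
    fresh-substᵛ (t ∷ ts) x∉ =
      cong₂ _∷_ (fresh-substᵗ t (x∉ ∘ here)) (fresh-substᵛ ts (x∉ ∘ there))

  fresh-substsᵗ : (zs : Vec ℕ n) (us : Vec (Term L) n) (t : Term L) →
                  All (λ z → ¬ (z ∈ₜ t)) zs → substsᵗ zs us t ≡ t
  fresh-substsᵗ []       []       t []         = refl
  fresh-substsᵗ (z ∷ zs) (u ∷ us) t (z∉ ∷ zs∉)
    rewrite fresh-substᵗ {z} {u} t z∉ = fresh-substsᵗ zs us t zs∉

  fresh-vars : ∀ {z} (zs : Vec ℕ n) → All (z ≢_) zs → ¬ Any (z ∈ₜ_) (Vec.map (var {L = L}) zs)
  fresh-vars (y ∷ zs) (z≢y ∷ _) (here var) = z≢y refl
  fresh-vars (y ∷ zs) (_ ∷ z∉)  (there p)  = fresh-vars zs z∉ p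

  Disjoint : Vec ℕ n → Vec (Term L) m → Set ℓ
  Disjoint zs us = All (λ z → All (λ u → ¬ (z ∈ₜ u)) us) zs

  substsᵛ-vars : (zs : Vec ℕ n) (us : Vec (Term L) n) → Unique zs → Disjoint zs us →
                 substsᵛ zs us (Vec.map var zs) ≡ us
  substsᵛ-vars []       []       _           _         = refl
  substsᵛ-vars (z ∷ zs) (u ∷ us) (z∉ ∷ uniq) (_ ∷ dis)
    rewrite fresh-substᵛ {u = u} (Vec.map var zs) (fresh-vars zs z∉)
          | substsᵛ-∷ zs us ((var z) [ z ≔ u ]ᵗ) (Vec.map var zs) =
    cong₂ _∷_ (trans (cong (substsᵗ zs us) (self z))
                     (fresh-substsᵗ zs us u (All.map All.head dis)))
              (substsᵛ-vars zs us uniq (All.map All.tail dis))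
    where
      self : ∀ z → (var z) [ z ≔ u ]ᵗ ≡ u
      self z with z ℕ.≟ z
      ... | yes _   = refl
      ... | no  z≢z = ⊥-elim (z≢z refl)

  ∀*-subst : ∀ {z u} (zs : Vec ℕ n) → All (z ≢_) zs →
             (∀*[ zs ] φ) [ z ≔ u ] ≡ ∀*[ zs ] φ [ z ≔ u ]
  ∀*-subst []       []         = refl
  ∀*-subst {z = z} (y ∷ zs) (z≢y ∷ z∉) with z ℕ.≟ y
  ... | yes z≡y = ⊥-elim (z≢y z≡y)
  ... | no  _   = cong (∀[ y ]_) (∀*-subst zs z∉)

  ∀*-substitutable : ∀ {z u} (zs : Vec ℕ n) → All (λ y → ¬ (y ∈ₜ u)) zs → QF φ →
                     Substitutable u z (∀*[ zs ] φ)
  ∀*-substitutable []       []        q = QF-substitutable q _ _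
  ∀*-substitutable (y ∷ zs) (y∉ ∷ ∉s) q = all y∉ (∀*-substitutable zs ∉s q)

  instantiate : (zs : Vec ℕ n) (us : Vec (Term L) n) → Unique zs → Disjoint zs us →
                QF φ → ⊢ ∀*[ zs ] φ → ⊢ substs zs us φ
  instantiate []       []       _           _         q p = p
  instantiate (z ∷ zs) (u ∷ us) (z∉ ∷ uniq) (_ ∷ dis) q p =
    instantiate zs us uniq (All.map All.tail dis) (QF-subst q z u)
      (subst ⊢_ (∀*-subst zs z∉)
        (mp p (axiom (∀1 z _ u (∀*-substitutable zs (All.map All.head dis) q)))))

  mutual
    boundᵗ : Term L → ℕ
    boundᵗ (var x)    = suc x
    boundᵗ (fun F ts) = boundᵛ ts

    boundᵛ : Vec (Term L) n → ℕ
    boundᵛ []       = 0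
    boundᵛ (t ∷ ts) = boundᵗ t ℕ.⊔ boundᵛ ts

  mutual
    ∈⇒<boundᵗ : ∀ {x} {t : Term L} → x ∈ₜ t → x ℕ.< boundᵗ t
    ∈⇒<boundᵗ var       = ℕ.≤-refl
    ∈⇒<boundᵗ (fun x∈) = ∈⇒<boundᵛ x∈

    ∈⇒<boundᵛ : ∀ {x} {ts : Vec (Term L) n} → Any (x ∈ₜ_) ts → x ℕ.< boundᵛ ts
    ∈⇒<boundᵛ (here x∈)  = ℕ.≤-trans (∈⇒<boundᵗ x∈) (ℕ.m≤m⊔n _ _)
    ∈⇒<boundᵛ (there x∈) = ℕ.≤-trans (∈⇒<boundᵛ x∈) (ℕ.m≤n⊔m _ _)

  fresh : ℕ → ∀ n → Vec ℕ n
  fresh k zero    = []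
  fresh k (suc n) = k ∷ fresh (suc k) n

  fresh-≥ : ∀ k n → All (k ℕ.≤_) (fresh k n)
  fresh-≥ k zero    = []
  fresh-≥ k (suc n) = ℕ.≤-refl ∷ All.map ℕ.<⇒≤ (fresh-≥ (suc k) n)

  fresh-unique : ∀ k n → Unique (fresh k n)
  fresh-unique k zero    = []
  fresh-unique k (suc n) = All.map ℕ.<⇒≢ (fresh-≥ (suc k) n) ∷ fresh-unique (suc k) n

  ∉-all : ∀ {z} (us : Vec (Term L) n) → boundᵛ us ℕ.≤ z → All (λ u → ¬ (z ∈ₜ u)) us
  ∉-all []       _ = []
  ∉-all (u ∷ us) b =
    (λ z∈u → ℕ.<-irrefl refl
      (ℕ.<-≤-trans (∈⇒<boundᵗ z∈u) (ℕ.≤-trans (ℕ.m≤m⊔n _ _) b))) ∷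
    ∉-all us (ℕ.≤-trans (ℕ.m≤n⊔m (boundᵗ u) _) b)

  fresh-disjoint : (us : Vec (Term L) n) → Disjoint (fresh (boundᵛ us) m) us
  fresh-disjoint us = All.map (∉-all us) (fresh-≥ (boundᵛ us) _)

  freshFor : Vec (Term L) n → Vec ℕ n
  freshFor {n} us = fresh (boundᵛ us) n

  instantiate-fresh : (us : Vec (Term L) n) → QF φ →
                      ⊢ ∀*[ freshFor us ] φ → ⊢ substs (freshFor us) us φ
  instantiate-fresh us = instantiate _ us (fresh-unique _ _) (fresh-disjoint us)

  fresh-vars-subst : (us : Vec (Term L) n) →
                     substsᵛ (freshFor us) us (Vec.map var (freshFor us)) ≡ us
  fresh-vars-subst us = substsᵛ-vars _ us (fresh-unique _ _) (fresh-disjoint us)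

  ≐-refl : (t : Term L) → ⊢ t ≐ t
  ≐-refl t = subst ⊢_ eq-inst
    (instantiate-fresh us (rel _ _) (axiom (similarity (S1 x))))
    where
      us = t ∷ []
      zs = freshFor us
      x = boundᵛ us
      eq-inst : substs zs us (var x ≐ var x) ≡ (t ≐ t)
      eq-inst = trans (substs-≐ zs us (var x) (var x))
        (cong₂ _≐_ x↦t x↦t)
        where
          x↦t : substsᵗ zs us (var x) ≡ t
          x↦t = ∷-injectiveˡ (fresh-vars-subst us)

  ≐-sym : (t s : Term L) → ⊢ t ≐ s ⇒ s ≐ t
  ≐-sym t s = subst ⊢_ eq-inst
    (instantiate-fresh us (rel _ _ ⇒ rel _ _)
      (axiom (similarity (S2 x y (fresh-unique x 2)))))
    where
      us = t ∷ s ∷ []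
      zs = freshFor us
      x = boundᵛ us
      y = suc x
      vars = trans (sym (substsᵛ-∷ zs us (var x) (var y ∷ []))) (fresh-vars-subst us)
      x↦ : substsᵗ zs us (var x) ≡ t
      x↦ = ∷-injectiveˡ vars
      y↦ : substsᵗ zs us (var y) ≡ s
      y↦ = ∷-injectiveˡ (trans (sym (substsᵛ-∷ zs us (var y) [])) (∷-injectiveʳ vars))
      eq-inst : substs zs us (var x ≐ var y ⇒ var y ≐ var x) ≡ (t ≐ s ⇒ s ≐ t)
      eq-inst
        rewrite substs-⇒ zs us (var x ≐ var y) (var y ≐ var x)
              | substs-≐ zs us (var x) (var y) | substs-≐ zs us (var y) (var x) =
        cong₂ _⇒_ (cong₂ _≐_ x↦ y↦) (cong₂ _≐_ y↦ x↦)

  ≐-trans : (t s r : Term L) → ⊢ t ≐ s & s ≐ r ⇒ t ≐ r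
  ≐-trans t s r = subst ⊢_ eq-inst
    (instantiate-fresh us ((rel _ _ &ꟴ rel _ _) ⇒ rel _ _)
      (axiom (similarity (S3 x y z (fresh-unique x 3)))))
    where
      us = t ∷ s ∷ r ∷ []
      zs = freshFor us
      x = boundᵛ us
      y = suc x
      z = suc y
      vars = trans (sym (substsᵛ-∷ zs us (var x) (var y ∷ var z ∷ []))) (fresh-vars-subst us)
      vars′ = trans (sym (substsᵛ-∷ zs us (var y) (var z ∷ []))) (∷-injectiveʳ vars)
      x↦ : substsᵗ zs us (var x) ≡ t
      x↦ = ∷-injectiveˡ vars
      y↦ : substsᵗ zs us (var y) ≡ s
      y↦ = ∷-injectiveˡ vars′
      z↦ : substsᵗ zs us (var z) ≡ r
      z↦ = ∷-injectiveˡ (trans (sym (substsᵛ-∷ zs us (var z) [])) (∷-injectiveʳ vars′))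
      eq-inst : substs zs us (var x ≐ var y & var y ≐ var z ⇒ var x ≐ var z) ≡
                (t ≐ s & s ≐ r ⇒ t ≐ r)
      eq-inst
        rewrite substs-⇒ zs us (var x ≐ var y & var y ≐ var z) (var x ≐ var z)
              | substs-& zs us (var x ≐ var y) (var y ≐ var z)
              | substs-≐ zs us (var x) (var y) | substs-≐ zs us (var y) (var z)
              | substs-≐ zs us (var x) (var z) =
        cong₂ _⇒_ (cong₂ _&_ (cong₂ _≐_ x↦ y↦) (cong₂ _≐_ y↦ z↦)) (cong₂ _≐_ x↦ z↦)

  record Vars (ts ss : Vec (Term L) n) : Set ℓ where
    field
      xs ys  : Vec ℕ n
      unique : Unique (xs ++ ys)
      dis    : Disjoint (xs ++ ys) (ts ++ ss)
    zs = xs ++ ys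
    us = ts ++ ss

    both : substsᵛ zs us (Vec.map var xs) ++ substsᵛ zs us (Vec.map var ys) ≡ ts ++ ss
    both = trans (sym (substsᵛ-++ zs us (Vec.map var xs) (Vec.map var ys)))
      (trans (cong (substsᵛ zs us) (sym (map-++ var xs ys)))
             (substsᵛ-vars zs us unique dis))

    xs↦ : substsᵛ zs us (Vec.map var xs) ≡ ts
    xs↦ = proj₁ (++-injective _ ts both)

    ys↦ : substsᵛ zs us (Vec.map var ys) ≡ ss
    ys↦ = proj₂ (++-injective _ ts both)

  vars : (ts ss : Vec (Term L) n) → Vars ts ss
  vars {n} ts ss with freshFor (ts ++ ss) | fresh-unique (boundᵛ (ts ++ ss)) (n ℕ.+ n)
                    | fresh-disjoint {m = n ℕ.+ n} (ts ++ ss)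
  ... | zs | uniq | dis with Vec.splitAt n zs
  ...   | xs , ys , refl = record { xs = xs ; ys = ys ; unique = uniq ; dis = dis }

  fun-cong : (F : Fun L n) (ts ss : Vec (Term L) n) →
             ⊢ ts ≐* ss ⇒ fun F ts ≐ fun F ss
  fun-cong F ts ss = subst ⊢_ eq-inst
    (instantiate zs us unique dis (QF-≐* _ _ ⇒ rel _ _)
      (axiom (similarity (C1 F xs ys unique))))
    where
      open Vars (vars ts ss)
      x̂s = Vec.map var xs
      ŷs = Vec.map var ys
      eq-inst : substs zs us (x̂s ≐* ŷs ⇒ fun F x̂s ≐ fun F ŷs) ≡
                (ts ≐* ss ⇒ fun F ts ≐ fun F ss)
      eq-inst
        rewrite substs-⇒ zs us (x̂s ≐* ŷs) (fun F x̂s ≐ fun F ŷs)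
              | substs-≐* zs us x̂s ŷs
              | substs-≐ zs us (fun F x̂s) (fun F ŷs)
              | substsᵗ-fun zs us F x̂s | substsᵗ-fun zs us F ŷs
              | xs↦ | ys↦ = refl

  rel-cong : (P : Rel L n) (ts ss : Vec (Term L) n) →
             ⊢ ts ≐* ss ⇒ (rel P ts ⇔ rel P ss)
  rel-cong P ts ss = subst ⊢_ eq-inst
    (instantiate zs us unique dis
      (QF-≐* _ _ ⇒ ((rel _ _ ⇒ rel _ _) &ꟴ (rel _ _ ⇒ rel _ _)))
      (axiom (similarity (C2 P xs ys unique))))
    where
      open Vars (vars ts ss)
      x̂s = Vec.map var xs
      ŷs = Vec.map var ys
      p = rel P x̂s
      q = rel P ŷs
      eq-inst : substs zs us (x̂s ≐* ŷs ⇒ (p ⇔ q)) ≡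
                (ts ≐* ss ⇒ (rel P ts ⇔ rel P ss))
      eq-inst
        rewrite substs-⇒ zs us (x̂s ≐* ŷs) (p ⇔ q)
              | substs-≐* zs us x̂s ŷs
              | substs-& zs us (p ⇒ q) (q ⇒ p)
              | substs-⇒ zs us p q | substs-⇒ zs us q p
              | substs-rel zs us P x̂s | substs-rel zs us P ŷs
              | xs↦ | ys↦ = refl

  infix 4 _≤∣_∣
  _≤∣_∣ : ℚ → Formula L → Set ℓ
  q ≤∣ φ ∣ = cut (real (degree Φ φ)) q

  ≃1 : 1ℚ ≤∣ φ ∣ → degree Φ φ ≃ᴵ 1ᴵ {ℓ}
  ≃1 {φ} 1∈φ = real≤1 (degree Φ φ) , λ q≤1 → down (real (degree Φ φ)) (lower q≤1) 1∈φ

  ≃1⁻¹ : degree Φ φ ≃ᴵ 1ᴵ {ℓ} → 1ℚ ≤∣ φ ∣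
  ≃1⁻¹ (_ , h) = h (lift ℚ.≤-refl)

  provable : ⊢ φ → 1ℚ ≤∣ φ ∣
  provable p q q<1 _ ¬e = ¬e ((1₀₁ , weaken p) , lift (ℚ.<⇒≤ q<1))

  degree-mono : ∀ {q} → ⊢ φ ⇒ ψ → q ≤∣ φ ∣ → q ≤∣ ψ ∣
  degree-mono p h r r<q 0≤r ¬e = h r r<q 0≤r λ ((s , s⇒φ) , r≤s) →
    ¬e ((s , hs s⇒φ p) , r≤s)

  degree-mp : ∀ {q} → ⊢ φ ⇒ (ψ ⇒ χ) → 1ℚ ≤∣ φ ∣ → q ≤∣ ψ ∣ → q ≤∣ χ ∣
  degree-mp {φ} {ψ} {χ} {q} p h k r r<q 0≤r ¬e with ℚ.<-dense r<q
  ... | m , r<m , m<q =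
    h ε ε<1 0≤ε λ ((a , a⇒φ) , ε≤a) →
    k m m<q (ℚ.≤-trans 0≤r (ℚ.<⇒≤ r<m)) λ ((b , b⇒ψ) , m≤b) →
    ¬e ( ( a &₀₁ b
         , hs (mp (axiom (R& a b)) &-snd)
              (uncurry (hs a⇒φ (hs p (mp b⇒ψ (axiom (Ł2 _ _ _)))))) )
       , lift (ℚ.≤-trans (r≤a+b-1 (lower ε≤a) (lower m≤b)) (ℚ.p≤q⊔p 0ℚ _)) )
    where
      open +-*-Solver
      ε = 1ℚ ℚ.- m ℚ.+ r
      ε<1 : ε ℚ.< 1ℚ
      ε<1 = lin< r<m (solve 2 (λ m r → con 1ℚ :- m :+ r :+ m := con 1ℚ :+ r) refl m r)
      m≤1 : m ℚ.≤ 1ℚ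
      m≤1 = ℚ.≤-trans (ℚ.<⇒≤ m<q) (lower (real≤1 (degree Φ ψ) k))
      0≤ε : 0ℚ ℚ.≤ ε
      0≤ε = lin≤ m≤1 0≤r
        (solve 2 (λ m r → con 0ℚ :+ (con 1ℚ :+ r) :=
                          con 1ℚ :- m :+ r :+ (m :+ con 0ℚ)) refl m r)
      r≤a+b-1 : ∀ {a b} → ε ℚ.≤ a → m ℚ.≤ b → r ℚ.≤ a ℚ.+ b ℚ.- 1ℚ
      r≤a+b-1 {a} {b} ε≤a m≤b = lin≤ ε≤a m≤b
        (solve 4 (λ m r a b → r :+ (a :+ b) :=
                              a :+ b :- con 1ℚ :+ (con 1ℚ :- m :+ r :+ m)) refl m r a b)

  _∼_ : Term L → Term L → Set ℓ
  t ∼ s = degree Φ (t ≐ s) ≃ᴵ 1ᴵ {ℓ}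

  ∼⇒≐* : {ts ss : Vec (Term L) n} → Pointwise _∼_ ts ss → 1ℚ ≤∣ ts ≐* ss ∣
  ∼⇒≐* [] q q<1 _ ¬e = ¬e ((1₀₁ , identity) , lift (ℚ.<⇒≤ q<1))
  ∼⇒≐* (t∼s ∷ [])         = ≃1⁻¹ t∼s
  ∼⇒≐* (t∼s ∷ u∼r ∷ ts∼ss) =
    degree-mp &-intro (≃1⁻¹ t∼s) (∼⇒≐* (u∼r ∷ ts∼ss))

module _ {L : Language ℓ} (Φ : Theory L) where
  open Congruence Φ

  -- The set of ∼-classes is the setoid of terms with ∼ as its equality.
  termSetoid : Setoid ℓ ℓ
  termSetoid = record
    { Carrier = Term L
    ; _≈_     = λ t s → degree Φ (t ≐ s) ≃ᴵ 1ᴵ {ℓ}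
    ; isEquivalence = record
      { refl  = λ {t} → ≃1 (provable (≐-refl t))
      ; sym   = λ {t} {s} t∼s → ≃1 (degree-mono (≐-sym t s) (≃1⁻¹ t∼s))
      ; trans = λ {t} {s} {r} t∼s s∼r → ≃1
          (degree-mono (≐-trans t s r) (degree-mp &-intro (≃1⁻¹ t∼s) (≃1⁻¹ s∼r)))
      }
    }

  termStructure : Structure L ℓ
  termStructure = record
    { domain    = termSetoid
    ; element   = var 0
    ; funᴹ      = fun
    ; funᴹ-cong = λ F {ts} {ss} ts∼ss →
        ≃1 (degree-mono (fun-cong F ts ss) (∼⇒≐* ts∼ss))
    ; relᴹ      = λ P ts → degree Φ (rel P ts)
    ; relᴹ-cong = λ P {ts} {ss} ts∼ss →
        degree-mp (hs (rel-cong P ts ss) &-fst) (∼⇒≐* ts∼ss) ,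
        degree-mp (hs (rel-cong P ts ss) &-snd) (∼⇒≐* ts∼ss)
    }

{-# OPTIONS --safe #-}

-- The homomorphism is evaluation of terms under v.  It is well defined because
-- the calculus is sound: if Φ proves r̄ → φ then r ≤ ‖φ‖ in every model of Φ, so
-- |φ| = 1 forces ‖φ‖ = 1; in a reduced model the latter turns |t ≈ s| = 1 into
-- equality of the values of t and s.  Uniqueness is induction on terms.

module Submission where

import Algebra.Properties.Monoid.Mult as Mult
open import Data.Empty using (⊥; ⊥-elim)
import Data.Integer as ℤ
import Data.Integer.Properties as ℤ
open import Data.Integer.Solver using () renaming (module +-*-Solver to ℤ-Solver)
open import Data.Nat as ℕ using (ℕ; zero; suc)
import Data.Nat.Properties as ℕ
open import Data.Product using (∃; ∃!; _,_; proj₁; proj₂)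
import Data.Rational as ℚ
open ℚ using (ℚ; mkℚ; 0ℚ; 1ℚ; toℚᵘ)
import Data.Rational.Properties as ℚ
open import Data.Rational.Solver using (module +-*-Solver)
import Data.Rational.Unnormalised as ℚᵘ
import Data.Rational.Unnormalised.Properties as ℚᵘ
open import Data.Sum using (inj₁; inj₂)
open import Data.Vec as Vec using (Vec; []; _∷_)
open import Data.Vec.Relation.Binary.Pointwise.Inductive using (Pointwise; []; _∷_)
open import Data.Vec.Relation.Unary.Any using (Any; here; there)
open import Function using (_∘_)
open import Level using (Level; Lift; lift; lower)
open import Relation.Binary using (Setoid)
open import Relation.Binary.PropositionalEquality
  using (_≡_; _≢_; refl; sym; trans; cong; cong₂; subst)
open import Relation.Nullary using (¬_; yes; no)

open import Defs

private
  variable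
    ℓ ℓ′ ℓ₁ ℓ₂ : Level
    n : ℕ

-- The Archimedean property of the rationals.

open Mult ℚ.+-0-monoid using () renaming (_×_ to _·_)

-- Unnormalised fractions keep the denominator of `p` for every multiple, so no reduction to lowest
-- terms enters the computation.
toℚᵘ-· : ∀ n p → toℚᵘ (n · p) ℚᵘ.≃ ℚᵘ.mkℚᵘ (ℤ.+ n ℤ.* ℚ.↥ p) (ℚ.denominator-1 p)
toℚᵘ-· zero    p          = ℚᵘ.*≡* refl
toℚᵘ-· (suc n) p@record{} =
  ℚᵘ.≃-trans (ℚ.toℚᵘ-homo-+ p (n · p))
    (ℚᵘ.≃-trans (ℚᵘ.+-congʳ (toℚᵘ p) (toℚᵘ-· n p))
      (ℚᵘ.*≡* (solve 3
        (λ n a d → (a :* d :+ (n :* a) :* d) :* d :=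
                   ((con (ℤ.+ 1) :+ n) :* a) :* (d :* d))
        refl (ℤ.+ n) (ℚ.↥ p) (ℚ.↧ p))))
  where open ℤ-Solver

archimedean : ∀ {δ} → 0ℚ ℚ.< δ → ∃ λ n → 1ℚ ℚ.≤ n · δ
archimedean {mkℚ a d c} 0<δ with ℚ.positive 0<δ
-- Here δ is (k + 1)/(d + 1), so its multiple by the denominator d + 1 is the positive integer k +
-- 1.
archimedean {δ@(mkℚ ℤ.+[1+ k ] d c)} 0<δ | _ = suc d , ℚ.toℚᵘ-cancel-≤
  (ℚᵘ.≤-respʳ-≃ (ℚᵘ.≃-sym (toℚᵘ-· (suc d) δ))
    (ℚᵘ.*≤* (ℤ.≤-trans (ℤ.≤-reflexive (ℤ.*-identityˡ (ℤ.+ suc d)))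
      (ℤ.≤-trans (ℤ.+≤+ (ℕ.m≤m*n (suc d) (suc k)))
        (ℤ.≤-reflexive (sym (ℤ.*-identityʳ _)))))))

-- Equality of truth values is a congruence.

⇒ᴵ-cong : (a a′ b b′ : 𝕀 ℓ) → a ≃ᴵ a′ → b ≃ᴵ b′ → (a ⇒ᴵ b) ≃ᴵ (a′ ⇒ᴵ b′)
⇒ᴵ-cong _ _ _ _ (a≤a′ , a′≤a) (b≤b′ , b′≤b) =
  (λ (q≤1 , h) → q≤1 , λ s s≤-b′ u u∈a′ → h s (λ w w∈b → s≤-b′ w (b≤b′ w∈b)) u (a′≤a u∈a′)) ,
  (λ (q≤1 , h) → q≤1 , λ s s≤-b u u∈a → h s (λ w w∈b′ → s≤-b w (b′≤b w∈b′)) u (a≤a′ u∈a))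

⨅-cong : {I : Set ℓ} {x y : I → 𝕀 ℓ} → (∀ i → x i ≃ᴵ y i) → ⨅ x ≃ᴵ ⨅ y
⨅-cong x≃y = (λ (q≤1 , h) → q≤1 , λ i → proj₁ (x≃y i) (h i))
           , (λ (q≤1 , h) → q≤1 , λ i → proj₂ (x≃y i) (h i))

≃ᴵ-refl : (a : 𝕀 ℓ) → a ≃ᴵ a
≃ᴵ-refl _ = (λ c → c) , (λ c → c)

≃ᴵ-trans : (a : 𝕀 ℓ₁) (b : 𝕀 ℓ₂) (c : 𝕀 ℓ) → a ≃ᴵ b → b ≃ᴵ c → a ≃ᴵ c
≃ᴵ-trans _ _ _ (f , f⁻¹) (g , g⁻¹) = (λ h → g (f h)) , (λ h → f⁻¹ (g⁻¹ h))

≡⇒≃ᴵ : {a b : 𝕀 ℓ} → a ≡ b → a ≃ᴵ b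
≡⇒≃ᴵ {a = a} refl = ≃ᴵ-refl a

-- Substitution for a variable that is not free.

module _ {L : Language ℓ} where

  -- Freshness in terms does not involve the theory that `Congruence` takes, so
  -- any theory will do.
  fresh-substᵛ : ∀ {x u} (ts : Vec (Term L) n) → ¬ Any (x ∈ₜ_) ts → ts [ x ≔ u ]ᵛ ≡ ts
  fresh-substᵛ = Congruence.fresh-substᵛ ∅
    where
      ∅ : Theory L
      ∅ = record { Axiom = λ _ → Lift _ ⊥ ; sentences = λ () }

  -- Settles the `notFree` case of the substitution lemma, where nothing is known about capture but
  -- the substitution leaves the formula as it is.
  fresh-subst : ∀ {x t} (φ : Formula L) → ¬ (x FreeIn φ) → φ [ x ≔ t ] ≡ φ
  fresh-subst (rel P ts) x∉ = cong (rel P) (fresh-substᵛ ts (x∉ ∘ rel))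
  fresh-subst (const r)  x∉ = refl
  fresh-subst (φ ⇒ ψ)    x∉ =
    cong₂ _⇒_ (fresh-subst φ (x∉ ∘ ⇒ˡ)) (fresh-subst ψ (x∉ ∘ ⇒ʳ))
  fresh-subst {x} (∀[ y ] φ) x∉ with x ℕ.≟ y
  ... | yes _   = refl
  ... | no  x≢y = cong (∀[ y ]_) (fresh-subst φ (x∉ ∘ all x≢y))

module Semantics {L : Language ℓ} (N : Structure L ℓ′) where
  open Structure N

  private
    module D = Setoid domain
    variable
      φ ψ χ : Formula L
      v w : Evaluation
      p q r u : ℚ
      s : ℚ₀₁

  -- Coincidence and substitution lemmas.

  mutual
    ⟦⟧ᵗ-local : (t : Term L) → (∀ x → x ∈ₜ t → v x ≡ w x) → ⟦ t ⟧ᵗ v ≡ ⟦ t ⟧ᵗ w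
    ⟦⟧ᵗ-local (var x)    v≡w = v≡w x var
    ⟦⟧ᵗ-local (fun F ts) v≡w = cong (funᴹ F) (⟦⟧ᵛ-local ts λ x x∈ → v≡w x (fun x∈))

    ⟦⟧ᵛ-local : (ts : Vec (Term L) n) → (∀ x → Any (x ∈ₜ_) ts → v x ≡ w x) →
                ⟦ ts ⟧ᵛ v ≡ ⟦ ts ⟧ᵛ w
    ⟦⟧ᵛ-local []       v≡w = refl
    ⟦⟧ᵛ-local (t ∷ ts) v≡w = cong₂ _∷_ (⟦⟧ᵗ-local t λ x x∈ → v≡w x (here x∈))
                                       (⟦⟧ᵛ-local ts λ x x∈ → v≡w x (there x∈))

  ↦-local : ∀ y d (φ : Formula L) → (∀ x → x FreeIn (∀[ y ] φ) → v x ≡ w x) →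
            ∀ x → x FreeIn φ → (v [ y ↦ d ]) x ≡ (w [ y ↦ d ]) x
  ↦-local y d φ v≡w x x∈ with y ℕ.≟ x
  ... | yes _   = refl
  ... | no  y≢x = v≡w x (all (y≢x ∘ sym) x∈)

  ⟦⟧-local : (φ : Formula L) → (∀ x → x FreeIn φ → v x ≡ w x) → ⟦ φ ⟧ v ≃ᴵ ⟦ φ ⟧ w
  ⟦⟧-local {v} {w} (rel P ts) v≡w = ≡⇒≃ᴵ {a = ⟦ rel P ts ⟧ v} {⟦ rel P ts ⟧ w}
    (cong (relᴹ P) (⟦⟧ᵛ-local ts λ x x∈ → v≡w x (rel x∈)))
  ⟦⟧-local         (const r)  v≡w = ≃ᴵ-refl (ratᴵ r)
  ⟦⟧-local {v} {w} (φ ⇒ ψ)    v≡w = ⇒ᴵ-cong (⟦ φ ⟧ v) (⟦ φ ⟧ w) (⟦ ψ ⟧ v) (⟦ ψ ⟧ w)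
    (⟦⟧-local φ λ x x∈ → v≡w x (⇒ˡ x∈)) (⟦⟧-local ψ λ x x∈ → v≡w x (⇒ʳ x∈))
  ⟦⟧-local {v} {w} (∀[ y ] φ) v≡w =
    ⨅-cong {x = λ d → ⟦ φ ⟧ (v [ y ↦ d ])} {λ d → ⟦ φ ⟧ (w [ y ↦ d ])} λ d →
      ⟦⟧-local φ (↦-local y d φ v≡w)

  ↦-≡ : ∀ {x y} d → x ≡ y → (v [ x ↦ d ]) y ≡ d
  ↦-≡ {x = x} {y} d x≡y with x ℕ.≟ y
  ... | yes _   = refl
  ... | no  x≢y = ⊥-elim (x≢y x≡y)

  ↦-≢ : ∀ v x d {y} → x ≢ y → (v [ x ↦ d ]) y ≡ v y
  ↦-≢ v x d {y} x≢y with x ℕ.≟ y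
  ... | yes x≡y = ⊥-elim (x≢y x≡y)
  ... | no  _   = refl

  ⟦⟧-fresh : ∀ {x} d (φ : Formula L) → ¬ (x FreeIn φ) → ⟦ φ ⟧ v ≃ᴵ ⟦ φ ⟧ (v [ x ↦ d ])
  ⟦⟧-fresh {v = v} {x} d φ x∉ = ⟦⟧-local φ λ y y∈ → sym (↦-≢ v x d λ { refl → x∉ y∈ })

  ↦-comm : ∀ {x y} d e → x ≢ y → ∀ z →
           ((v [ y ↦ e ]) [ x ↦ d ]) z ≡ ((v [ x ↦ d ]) [ y ↦ e ]) z
  ↦-comm {v = v} {x = x} {y} d e x≢y z with x ℕ.≟ z | y ℕ.≟ z
  ... | yes refl | yes refl = ⊥-elim (x≢y refl)
  ... | yes x≡z  | no  _    = sym (↦-≡ d x≡z)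
  ... | no  _    | yes y≡z  = ↦-≡ e y≡z
  ... | no  x≢z  | no  y≢z  = trans (↦-≢ v y e y≢z) (sym (↦-≢ v x d x≢z))

  mutual
    ⟦⟧ᵗ-subst : ∀ x s (t : Term L) → ⟦ t [ x ≔ s ]ᵗ ⟧ᵗ v ≡ ⟦ t ⟧ᵗ (v [ x ↦ ⟦ s ⟧ᵗ v ])
    ⟦⟧ᵗ-subst x s (var y) with x ℕ.≟ y
    ... | yes _ = refl
    ... | no  _ = refl
    ⟦⟧ᵗ-subst x s (fun F ts) = cong (funᴹ F) (⟦⟧ᵛ-subst x s ts)

    ⟦⟧ᵛ-subst : ∀ x s (ts : Vec (Term L) n) →
                ⟦ ts [ x ≔ s ]ᵛ ⟧ᵛ v ≡ ⟦ ts ⟧ᵛ (v [ x ↦ ⟦ s ⟧ᵗ v ])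
    ⟦⟧ᵛ-subst x s []       = refl
    ⟦⟧ᵛ-subst x s (t ∷ ts) = cong₂ _∷_ (⟦⟧ᵗ-subst x s t) (⟦⟧ᵛ-subst x s ts)

  ∀-self : ∀ {x y} → x ≡ y → ¬ (x FreeIn (∀[ y ] φ))
  ∀-self refl (all x≢x _) = x≢x refl

  ⟦⟧-subst : ∀ (φ : Formula L) v x t → Substitutable t x φ →
             ⟦ φ [ x ≔ t ] ⟧ v ≃ᴵ ⟦ φ ⟧ (v [ x ↦ ⟦ t ⟧ᵗ v ])
  ⟦⟧-subst (rel P ts) v x t _ =
    ≡⇒≃ᴵ {a = ⟦ rel P ts [ x ≔ t ] ⟧ v} {⟦ rel P ts ⟧ (v [ x ↦ ⟦ t ⟧ᵗ v ])}
      (cong (relᴹ P) (⟦⟧ᵛ-subst x t ts))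
  ⟦⟧-subst (const r)  v x t _         = ≃ᴵ-refl (ratᴵ r)
  ⟦⟧-subst (φ ⇒ ψ)    v x t (Sφ ⇒ Sψ) =
    ⇒ᴵ-cong (⟦ φ [ x ≔ t ] ⟧ v) (⟦ φ ⟧ v′) (⟦ ψ [ x ≔ t ] ⟧ v) (⟦ ψ ⟧ v′)
      (⟦⟧-subst φ v x t Sφ) (⟦⟧-subst ψ v x t Sψ)
    where v′ = v [ x ↦ ⟦ t ⟧ᵗ v ]
  ⟦⟧-subst φ₀@(∀[ y ] φ) v x t (notFree x∉) =
    subst (λ ψ → ⟦ ψ ⟧ v ≃ᴵ ⟦ φ₀ ⟧ (v [ x ↦ ⟦ t ⟧ᵗ v ])) (sym (fresh-subst φ₀ x∉))
      (⟦⟧-fresh _ φ₀ x∉)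
  ⟦⟧-subst (∀[ y ] φ) v x t (all y∉t Sφ) with x ℕ.≟ y
  ... | yes x≡y = ⟦⟧-fresh _ (∀[ y ] φ) (∀-self x≡y)
  -- Since y does not occur in t, the value of t is the same before and after the update at y; the
  -- updates at x and y then commute.
  ... | no  x≢y =
    ⨅-cong {x = λ d → ⟦ φ [ x ≔ t ] ⟧ (v [ y ↦ d ])} {λ d → ⟦ φ ⟧ (v′ [ y ↦ d ])} λ d →
      ≃ᴵ-trans (⟦ φ [ x ≔ t ] ⟧ (v [ y ↦ d ])) (⟦ φ ⟧ (v″ d)) (⟦ φ ⟧ (v′ [ y ↦ d ]))
        (⟦⟧-subst φ (v [ y ↦ d ]) x t Sφ) (⟦⟧-local φ λ z _ →
          trans (cong (λ e → ((v [ y ↦ d ]) [ x ↦ e ]) z)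
                      (⟦⟧ᵗ-local t λ z z∈ → ↦-≢ v y d λ { refl → y∉t z∈ }))
                (↦-comm _ d x≢y z))
    where
      v′ = v [ x ↦ ⟦ t ⟧ᵗ v ]
      v″ = λ d → (v [ y ↦ d ]) [ x ↦ ⟦ t ⟧ᵗ (v [ y ↦ d ]) ]

  -- Rational lower bounds of truth values.

  infix 4 _≼[_]_

  -- Reads: q is at most the value of φ under v. A bare membership in the cut would unfold along
  -- `⟦_⟧`, and v and φ could not be recovered from it by unification; the record prevents this.
  record _≼[_]_ (q : ℚ) (v : Evaluation) (φ : Formula L) : Set ℓ′ where
    constructor ⟨_⟩
    field
      in-cut : cut (real (⟦ φ ⟧ v)) q
  open _≼[_]_

  open +-*-Solver using (solve; con; _:+_; _:-_; :-_; _:=_)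

  ≼-resp : ∀ {v w φ ψ} → ⟦ φ ⟧ v ≃ᴵ ⟦ ψ ⟧ w → q ≼[ v ] φ → q ≼[ w ] ψ
  ≼-resp φ≃ψ q≼φ = ⟨ proj₁ φ≃ψ (in-cut q≼φ) ⟩

  ≼-resp⁻¹ : ∀ {v w φ ψ} → ⟦ φ ⟧ v ≃ᴵ ⟦ ψ ⟧ w → q ≼[ w ] ψ → q ≼[ v ] φ
  ≼-resp⁻¹ φ≃ψ q≼ψ = ⟨ proj₂ φ≃ψ (in-cut q≼ψ) ⟩

  ≼-down : p ℚ.≤ q → q ≼[ v ] φ → p ≼[ v ] φ
  ≼-down {v = v} {φ} p≤q q≼φ = ⟨ down (real (⟦ φ ⟧ v)) p≤q (in-cut q≼φ) ⟩

  ≼⇒≤1 : q ≼[ v ] φ → q ℚ.≤ 1ℚ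
  ≼⇒≤1 {v = v} {φ} q≼φ = lower (real≤1 (⟦ φ ⟧ v) (in-cut q≼φ))

  ≤0⇒≼ : q ℚ.≤ 0ℚ → q ≼[ v ] φ
  ≤0⇒≼ {v = v} {φ} q≤0 = ⟨ 0≤real (⟦ φ ⟧ v) (lift q≤0) ⟩

  ≰⇒> : q ≼[ v ] φ → ¬ (p ≼[ v ] φ) → q ℚ.< p
  ≰⇒> q≼φ p⋠φ = ℚ.≰⇒> λ p≤q → p⋠φ (≼-down p≤q q≼φ)

  -- Closedness reduces the claim to each p below q, and stability allows refuting the failure of p.
  -- A failing p exceeds 0, because 0 bounds every truth value, so 0 ≤ p comes for free.
  ≼-approx : (∀ p → p ℚ.< q → 0ℚ ℚ.≤ p → ¬ ¬ (p ≼[ v ] φ)) → q ≼[ v ] φ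
  ≼-approx {v = v} {φ} h = ⟨ closed (real (⟦ φ ⟧ v)) (λ p p<q →
    stable (real (⟦ φ ⟧ v)) λ p⋠φ → h p p<q
      (ℚ.<⇒≤ (≰⇒> {φ = φ} (≤0⇒≼ ℚ.≤-refl) (p⋠φ ∘ in-cut)))
      (p⋠φ ∘ in-cut)) ⟩

  const-intro : q ℚ.≤ value s → q ≼[ v ] const s
  const-intro q≤s = ⟨ lift q≤s ⟩

  const-elim : q ≼[ v ] const s → q ℚ.≤ value s
  const-elim q≼s = lower (in-cut q≼s)

  -- One half of residuation, with `⇒-elim` as the other. The strong conjunction of q and u appears
  -- as q + u - 1 without the maximum with 0, since nonpositive rationals bound every value anyway.
  ⇒-intro : q ℚ.≤ 1ℚ → (∀ u → u ≼[ v ] φ → q ℚ.+ u ℚ.- 1ℚ ≼[ v ] ψ) → q ≼[ v ] (φ ⇒ ψ)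
  -- Addition of reals is encoded as subtraction of 0 - ψ: a rational t below 0 - ψ satisfies t + s
  -- ≤ 0 for all s below ψ, and s = q + u - 1 gives q + t + u ≤ 1.
  ⇒-intro {q} q≤1 h = ⟨ lift q≤1 , (λ t t≤-ψ u u∈φ → lift (lin≤¹
    (lower (t≤-ψ (q ℚ.+ u ℚ.- 1ℚ) (in-cut (h u ⟨ u∈φ ⟩))))
    (solve 3 (λ q t u → q :+ t :+ u :+ con 0ℚ := con 1ℚ :+ (t :+ (q :+ u :- con 1ℚ)))
      refl q t u))) ⟩

  -- Were q + u - 1 above the value of ψ, some p below it would bound ψ strictly,
  -- and -p would be a rational below the value of 0 - ψ.
  ⇒-elim : q ≼[ v ] (φ ⇒ ψ) → u ≼[ v ] φ → q ℚ.+ u ℚ.- 1ℚ ≼[ v ] ψ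
  ⇒-elim {q} {ψ = ψ} {u} q≼φ⇒ψ u≼φ = ≼-approx λ p p<q+u-1 _ p⋠ψ →
    ℚ.<-irrefl refl (ℚ.<-≤-trans p<q+u-1 (lin≤¹
      (lower (proj₂ (in-cut q≼φ⇒ψ) (ℚ.- p)
        (λ w w∈ψ → lift (lin≤¹ (ℚ.<⇒≤ (≰⇒> {φ = ψ} ⟨ w∈ψ ⟩ p⋠ψ))
          (solve 2 (λ p w → :- p :+ w :+ p := con 0ℚ :+ w) refl p w)))
        u (in-cut u≼φ)))
      (solve 3 (λ q u p → q :+ u :- con 1ℚ :+ con 1ℚ := p :+ (q :+ :- p :+ u))
        refl q u p)))

  ∀-intro : ∀ {x} → q ℚ.≤ 1ℚ → (∀ d → q ≼[ v [ x ↦ d ] ] φ) → q ≼[ v ] (∀[ x ] φ)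
  ∀-intro q≤1 h = ⟨ lift q≤1 , (λ d → in-cut (h d)) ⟩

  ∀-elim : ∀ {x} → q ≼[ v ] (∀[ x ] φ) → ∀ d → q ≼[ v [ x ↦ d ] ] φ
  ∀-elim h d = ⟨ proj₂ (in-cut h) d ⟩

  -- Validity of the logical axioms.

  infix 4 _⊨_

  _⊨_ : Evaluation → Formula L → Set ℓ′
  v ⊨ φ = 1ℚ ≼[ v ] φ

  ⊨-⇒-intro : (∀ q → q ≼[ v ] φ → q ≼[ v ] ψ) → v ⊨ (φ ⇒ ψ)
  ⊨-⇒-intro h = ⇒-intro ℚ.≤-refl λ u u≼φ →
    ≼-down (ℚ.≤-reflexive (solve 1 (λ u → con 1ℚ :+ u :- con 1ℚ := u) refl u)) (h u u≼φ)

  ⊨-⇒-elim : v ⊨ (φ ⇒ ψ) → q ≼[ v ] φ → q ≼[ v ] ψ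
  ⊨-⇒-elim {q = q} h q≼φ =
    ≼-down (ℚ.≤-reflexive (solve 1 (λ q → q := con 1ℚ :+ q :- con 1ℚ) refl q)) (⇒-elim h q≼φ)

  ⊨-⇔-intro : (∀ q → q ≼[ v ] φ → q ≼[ v ] ψ) → (∀ q → q ≼[ v ] ψ → q ≼[ v ] φ) →
              v ⊨ (φ ⇔ ψ)
  -- The conjunction unfolds to the negation of an implication into a negation; discharging both
  -- implications at value 1 bounds q by 0.
  ⊨-⇔-intro φ≤ψ ψ≤φ = ⊨-⇒-intro λ q q≼ → ≼-down
    (ℚ.≤-reflexive (solve 1 (λ q → q := q :+ con 1ℚ :- con 1ℚ :+ con 1ℚ :- con 1ℚ) refl q))
    (⇒-elim (⇒-elim q≼ (⊨-⇒-intro φ≤ψ)) (⊨-⇒-intro ψ≤φ))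

  ⊨-Ł1 : v ⊨ (φ ⇒ (ψ ⇒ φ))
  ⊨-Ł1 = ⊨-⇒-intro λ q q≼φ → ⇒-intro (≼⇒≤1 q≼φ) λ u u≼ψ →
    ≼-down (lin≤¹ (≼⇒≤1 u≼ψ)
      (solve 2 (λ q u → q :+ u :- con 1ℚ :+ con 1ℚ := q :+ u) refl q u)) q≼φ

  ⊨-Ł2 : v ⊨ ((φ ⇒ ψ) ⇒ ((ψ ⇒ χ) ⇒ (φ ⇒ χ)))
  ⊨-Ł2 = ⊨-⇒-intro λ q q≼φ⇒ψ → ⇒-intro (≼⇒≤1 q≼φ⇒ψ) λ r r≼ψ⇒χ →
    ⇒-intro (lin≤ (≼⇒≤1 q≼φ⇒ψ) (≼⇒≤1 r≼ψ⇒χ)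
      (solve 2 (λ q r → q :+ r :- con 1ℚ :+ (con 1ℚ :+ con 1ℚ) := con 1ℚ :+ (q :+ r))
        refl q r)) λ u u≼φ →
    ≼-down (ℚ.≤-reflexive
      (solve 3 (λ q r u → q :+ r :- con 1ℚ :+ u :- con 1ℚ :=
                          r :+ (q :+ u :- con 1ℚ) :- con 1ℚ) refl q r u))
      (⇒-elim r≼ψ⇒χ (⇒-elim q≼φ⇒ψ u≼φ))

  ⊨-Ł3 : v ⊨ ((~ φ ⇒ ~ ψ) ⇒ (ψ ⇒ φ))
  ⊨-Ł3 {φ = φ} = ⊨-⇒-intro λ q q≼ → ⇒-intro (≼⇒≤1 q≼) λ u u≼ψ →
    ≼-approx λ p p<q+u-1 0≤p p⋠φ → ℚ.<-irrefl refl (ℚ.<-≤-trans p<q+u-1 (lin≤¹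
      (const-elim (⇒-elim
        -- As φ stays below p, its negation is at least 1 - p. Hence q - p bounds the negation of ψ,
        -- and u below ψ yields q + u - 1 ≤ p.
        (⇒-elim {u = 1ℚ ℚ.- p} q≼ (⇒-intro
          (lin≤¹ 0≤p (solve 1 (λ p → con 1ℚ :- p :+ p := con 1ℚ :+ con 0ℚ) refl p))
          λ w w≼φ → const-intro (lin≤¹ (ℚ.<⇒≤ (≰⇒> w≼φ p⋠φ))
            (solve 2 (λ p w → con 1ℚ :- p :+ w :- con 1ℚ :+ p := con 0ℚ :+ w) refl p w))))
        u≼ψ))
      (solve 3 (λ q u p → q :+ u :- con 1ℚ :+ con 0ℚ :=
                          p :+ (q :+ (con 1ℚ :- p) :- con 1ℚ :+ u :- con 1ℚ)) refl q u p)))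

  -- Starting from 0, which is always a lower bound, finitely many steps of size δ reach 1.
  +-closed⇒⊨ : ∀ {δ} → 0ℚ ℚ.< δ → (∀ u → u ≼[ v ] φ → δ ℚ.+ u ≼[ v ] φ) → v ⊨ φ
  +-closed⇒⊨ {v} {φ} {δ} 0<δ step = ≼-down (proj₂ (archimedean 0<δ)) (multiple (proj₁ (archimedean 0<δ)))
    where
      multiple : ∀ n → n · δ ≼[ v ] φ
      multiple zero    = ≤0⇒≼ ℚ.≤-refl
      multiple (suc n) = step (n · δ) (multiple n)

  -- Suppose p ≼ φ fails for some p < q + r - 1.  Then p ≼ ψ fails too, and hence
  -- the value of ψ is closed under adding q - p > 0, which is absurd.
  ⊨-Ł4 : v ⊨ (((φ ⇒ ψ) ⇒ ψ) ⇒ ((ψ ⇒ φ) ⇒ φ))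
  ⊨-Ł4 {v} {φ} {ψ} = ⊨-⇒-intro λ q q≼ → ⇒-intro (≼⇒≤1 q≼) λ r r≼ψ⇒φ →
    ≼-approx λ p p<q+r-1 0≤p p⋠φ → let
      p<q : p ℚ.< q
      p<q = ℚ.<-≤-trans p<q+r-1 (lin≤¹ (≼⇒≤1 r≼ψ⇒φ)
        (solve 2 (λ q r → q :+ r :- con 1ℚ :+ con 1ℚ := q :+ r) refl q r))

      p⋠ψ : ¬ (p ≼[ v ] ψ)
      -- Every u below φ is below p, hence below ψ, so φ ⇒ ψ has value 1. Then q bounds ψ, and q + r
      -- - 1 bounds φ.
      p⋠ψ p≼ψ = p⋠φ (≼-down
        (ℚ.≤-trans (ℚ.<⇒≤ p<q+r-1) (ℚ.≤-reflexive
          (solve 2 (λ q r → q :+ r :- con 1ℚ := r :+ (q :+ con 1ℚ :- con 1ℚ) :- con 1ℚ)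
            refl q r)))
        (⇒-elim r≼ψ⇒φ (⇒-elim q≼ (⊨-⇒-intro λ u u≼φ →
          ≼-down (ℚ.<⇒≤ (≰⇒> u≼φ p⋠φ)) p≼ψ))))

      step : ∀ u → u ≼[ v ] ψ → (q ℚ.- p) ℚ.+ u ≼[ v ] ψ
      -- Because φ lies below p, the implication φ ⇒ ψ is at least 1 - p + u; combining this with q
      -- leaves q - p + u.
      step u u≼ψ = ≼-down
        (ℚ.≤-reflexive (solve 3 (λ p q u → q :- p :+ u := q :+ (con 1ℚ :- p :+ u) :- con 1ℚ)
          refl p q u))
        (⇒-elim q≼ (⇒-intro
          (lin≤¹ (ℚ.<⇒≤ (≰⇒> u≼ψ p⋠ψ))
            (solve 2 (λ p u → con 1ℚ :- p :+ u :+ p := con 1ℚ :+ u) refl p u))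
          λ w w≼φ → ≼-down (lin≤¹ (ℚ.<⇒≤ (≰⇒> w≼φ p⋠φ))
            (solve 3 (λ p u w → con 1ℚ :- p :+ u :+ w :- con 1ℚ :+ p := u :+ w) refl p u w))
            u≼ψ))
      in p⋠ψ (≼-down (ℚ.≤-trans (ℚ.<⇒≤ p<q) (≼⇒≤1 q≼))
           (+-closed⇒⊨ {δ = q ℚ.- p} (lin< p<q (solve 2 (λ p q → con 0ℚ :+ q := q :- p :+ p) refl p q))
             step))

  ⊨-R⇒ : ∀ r s → v ⊨ ((const r ⇒ const s) ⇔ const (r ⇒₀₁ s))
  ⊨-R⇒ r s = ⊨-⇔-intro
    (λ q q≼ → const-intro (ℚ.⊓-glb {q} {1ℚ} {t} (≼⇒≤1 q≼)
      (lin≤¹ (const-elim (⇒-elim q≼ (const-intro {s = r} ℚ.≤-refl)))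
        (solve 3 (λ q r s → q :+ s := con 1ℚ :- r :+ s :+ (q :+ r :- con 1ℚ))
          refl q (value r) (value s)))))
    (λ q q≼ → ⇒-intro (≼⇒≤1 q≼) λ u u≼r → const-intro (lin≤
      (ℚ.≤-trans (const-elim q≼) (ℚ.p⊓q≤q 1ℚ t)) (const-elim u≼r)
      (solve 4 (λ q u r s → q :+ u :- con 1ℚ :+ (con 1ℚ :- r :+ s :+ r) := s :+ (q :+ u))
        refl q u (value r) (value s))))
    where t = 1ℚ ℚ.- value r ℚ.+ value s

  ⊨-R& : ∀ r s → v ⊨ ((const r & const s) ⇔ const (r &₀₁ s))
  ⊨-R& {v} r s = ⊨-⇔-intro
    (λ q q≼ → const-intro (above q q≼))
    (λ q q≼ → ⇒-intro (≼⇒≤1 q≼) λ u u≼ → const-intro (below q (const-elim q≼) u u≼))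
    where
      t = value r ℚ.+ value s ℚ.- 1ℚ

      above : ∀ q → q ≼[ v ] (const r & const s) → q ℚ.≤ 0ℚ ℚ.⊔ t
      above q q≼ with ℚ.≤-total t 0ℚ
      -- When r + s ≤ 1 the implication from r to the negation of s has value 1, which forces q ≤ 0.
      ... | inj₁ t≤0 = ℚ.≤-trans
        (lin≤¹ (const-elim (⇒-elim q≼ (⇒-intro ℚ.≤-refl λ x x≼r → ⇒-intro
          (lin≤¹ (≼⇒≤1 x≼r)
            (solve 1 (λ x → con 1ℚ :+ x :- con 1ℚ :+ con 1ℚ := con 1ℚ :+ x) refl x))
          λ y y≼s → const-intro (lin≤
            (ℚ.+-mono-≤ (const-elim x≼r) (const-elim y≼s)) t≤0
            (solve 4 (λ x y r s → con 1ℚ :+ x :- con 1ℚ :+ y :- con 1ℚ :+ (r :+ s :+ con 0ℚ) :=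
                                  con 0ℚ :+ (x :+ y :+ (r :+ s :- con 1ℚ)))
              refl x y (value r) (value s))))))
          (solve 1 (λ q → q :+ con 0ℚ := con 0ℚ :+ (q :+ con 1ℚ :- con 1ℚ)) refl q))
        (ℚ.p≤p⊔q 0ℚ t)
      -- Otherwise that implication is at least 1 - t, which forces q ≤ t.
      ... | inj₂ 0≤t = ℚ.≤-trans
        (lin≤¹ (const-elim (⇒-elim {u = 1ℚ ℚ.- t} q≼ (⇒-intro
          (lin≤¹ 0≤t (solve 1 (λ t → con 1ℚ :- t :+ t := con 1ℚ :+ con 0ℚ) refl t))
          λ x x≼r → ⇒-intro
          (lin≤ (≼⇒≤1 x≼r) 0≤t
            (solve 2 (λ x t → con 1ℚ :- t :+ x :- con 1ℚ :+ (con 1ℚ :+ t) :=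
                              con 1ℚ :+ (x :+ con 0ℚ)) refl x t))
          λ y y≼s → const-intro (lin≤ (const-elim x≼r) (const-elim y≼s)
            (solve 4 (λ x y r s →
                con 1ℚ :- (r :+ s :- con 1ℚ) :+ x :- con 1ℚ :+ y :- con 1ℚ :+ (r :+ s) :=
                con 0ℚ :+ (x :+ y))
              refl x y (value r) (value s))))))
          (solve 2 (λ q t → q :+ con 0ℚ := t :+ (q :+ (con 1ℚ :- t) :- con 1ℚ)) refl q t))
        (ℚ.p≤q⊔p 0ℚ t)

      below : ∀ q → q ℚ.≤ 0ℚ ℚ.⊔ t → ∀ u → u ≼[ v ] (const r ⇒ ~ const s) →
              q ℚ.+ u ℚ.- 1ℚ ℚ.≤ 0ℚ
      below q q≤ u u≼ with ℚ.≤-total t 0ℚ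
      ... | inj₁ t≤0 = lin≤ (ℚ.≤-trans q≤ (ℚ.⊔-lub ℚ.≤-refl t≤0)) (≼⇒≤1 u≼)
        (solve 2 (λ q u → q :+ u :- con 1ℚ :+ (con 0ℚ :+ con 1ℚ) := con 0ℚ :+ (q :+ u))
          refl q u)
      ... | inj₂ 0≤t = lin≤ (ℚ.≤-trans q≤ (ℚ.⊔-lub 0≤t ℚ.≤-refl))
        (const-elim (⇒-elim (⇒-elim u≼ (const-intro {s = r} ℚ.≤-refl))
                            (const-intro {s = s} ℚ.≤-refl)))
        (solve 4 (λ q u r s → q :+ u :- con 1ℚ :+ (r :+ s :- con 1ℚ :+ con 0ℚ) :=
                              con 0ℚ :+ (q :+ (u :+ r :- con 1ℚ :+ s :- con 1ℚ)))
          refl q u (value r) (value s))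

  ⊨-∀1 : ∀ {x t} → Substitutable t x φ → v ⊨ (∀[ x ] φ ⇒ φ [ x ≔ t ])
  ⊨-∀1 {φ} {v} {x} {t} S = ⊨-⇒-intro λ q q≼ →
    ≼-resp⁻¹ (⟦⟧-subst φ v x t S) (∀-elim q≼ (⟦ t ⟧ᵗ v))

  ⊨-∀2 : ∀ {x} → ¬ (x FreeIn φ) → v ⊨ (∀[ x ] (φ ⇒ ψ) ⇒ (φ ⇒ ∀[ x ] ψ))
  ⊨-∀2 {φ} x∉φ = ⊨-⇒-intro λ q q≼ → ⇒-intro (≼⇒≤1 q≼) λ u u≼φ →
    ∀-intro
      (lin≤ (≼⇒≤1 q≼) (≼⇒≤1 u≼φ)
        (solve 2 (λ q u → q :+ u :- con 1ℚ :+ (con 1ℚ :+ con 1ℚ) := con 1ℚ :+ (q :+ u))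
          refl q u))
      λ d → ⇒-elim (∀-elim q≼ d) (≼-resp (⟦⟧-fresh d φ x∉φ) u≼φ)

  ‖‖≃1⇒⊨ : ‖ φ ‖ ≃ᴵ 1ᴵ {ℓ′} → ∀ v → v ⊨ φ
  ‖‖≃1⇒⊨ (_ , 1≤φ) v = ⟨ proj₂ (1≤φ (lift ℚ.≤-refl)) v ⟩

  ⊨-rel : ∀ {P : Rel L n} {ts} → v ⊨ rel P ts → relᴹ P (⟦ ts ⟧ᵛ v) ≃ᴵ 1ᴵ {ℓ′}
  ⊨-rel {v = v} {P = P} {ts} h =
    real≤1 (relᴹ P (⟦ ts ⟧ᵛ v)) , λ q≤1 → in-cut (≼-down (lower q≤1) h)

  -- Soundness of provability and of provability degrees.

  module _ {Φ : Theory L} (N⊨Φ : IsModel N Φ) where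
    open IsModel N⊨Φ

    logical-sound : LogicalAxiom φ → ∀ v → v ⊨ φ
    logical-sound (Ł1 _ _)       v = ⊨-Ł1
    logical-sound (Ł2 _ _ _)     v = ⊨-Ł2
    logical-sound (Ł3 _ _)       v = ⊨-Ł3
    logical-sound (Ł4 _ _)       v = ⊨-Ł4
    logical-sound (R⇒ r s)       v = ⊨-R⇒ r s
    logical-sound (R& r s)       v = ⊨-R& r s
    logical-sound (∀1 _ _ _ S)   v = ⊨-∀1 S
    logical-sound (∀2 _ _ _ x∉)  v = ⊨-∀2 x∉
    logical-sound (similarity s) v = ‖‖≃1⇒⊨ (⊨similarity s) v

    -- Induction on the derivation for all evaluations at once, since generalization calls on the
    -- hypothesis at every update of v.
    sound : Φ ⊢ φ → ∀ v → v ⊨ φ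
    sound (hyp h)     v = ‖‖≃1⇒⊨ (⊨theory h) v
    sound (axiom a)   v = logical-sound a v
    sound (mp d e)    v = ⊨-⇒-elim (sound e v) (sound d v)
    sound (gen x d)   v = ∀-intro ℚ.≤-refl λ e → sound d (v [ x ↦ e ])

    -- Degree 1 as a supremum need not be attained: for each p < 1 it only gives, up to double
    -- negation, a provable implication from some r ≥ p. Soundness turns this into the bound p, and
    -- the bounds approximate 1.
    degree-sound : degree Φ φ ≃ᴵ 1ᴵ {ℓ} → ∀ v → v ⊨ φ
    degree-sound (_ , 1≤φ) v = ≼-approx λ p p<1 0≤p p⋠φ →
      1≤φ (lift ℚ.≤-refl) p p<1 0≤p λ ((r , r⇒φ) , p≤r) →
        p⋠φ (⊨-⇒-elim (sound r⇒φ v) (const-intro {s = r} (lower p≤r)))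

  -- The evaluation homomorphism and its uniqueness.

  -- Links the recursion on argument vectors in the semantics with the `Vec.map` in the homomorphism
  -- conditions.
  ⟦⟧ᵛ-map : (ts : Vec (Term L) n) → ⟦ ts ⟧ᵛ v ≡ Vec.map (λ t → ⟦ t ⟧ᵗ v) ts
  ⟦⟧ᵛ-map []       = refl
  ⟦⟧ᵛ-map (t ∷ ts) = cong (_ ∷_) (⟦⟧ᵛ-map ts)

  module _ {Φ : Theory L} (N⊨Φ : IsModel N Φ) (reduced : Reduced N) (v : Evaluation) where

    evaluate : Homomorphism (termStructure Φ) N
    evaluate = record
      { map      = record
        { to   = λ t → ⟦ t ⟧ᵗ v
        ; cong = λ t∼s → proj₁ (reduced _ _) (⊨-rel (degree-sound N⊨Φ t∼s v))
        }
      ; fun-homo = λ F ts → D.reflexive (cong (funᴹ F) (⟦⟧ᵛ-map ts))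
      ; rel-homo = λ P ts 1≤P → subst (λ ds → relᴹ P ds ≃ᴵ 1ᴵ {ℓ′}) (⟦⟧ᵛ-map ts)
          (⊨-rel (degree-sound N⊨Φ 1≤P v))
      }

  module _ {Φ : Theory L} (g : Homomorphism (termStructure Φ) N)
           (g-var : ∀ x → Homomorphism.to g (var x) ≈ v x) where
    open Homomorphism g using (to; fun-homo)

    mutual
      evaluate-uniqueᵗ : ∀ t → ⟦ t ⟧ᵗ v ≈ to t
      evaluate-uniqueᵗ (var x)    = D.sym (g-var x)
      evaluate-uniqueᵗ (fun F ts) =
        -- The arguments agree only up to `_≈_`, so `funᴹ-cong` carries this through F before
        -- `fun-homo` is applied backwards.
        D.trans (funᴹ-cong F (evaluate-uniqueᵛ ts)) (D.sym (fun-homo F ts))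

      evaluate-uniqueᵛ : (ts : Vec (Term L) n) → Pointwise _≈_ (⟦ ts ⟧ᵛ v) (Vec.map to ts)
      evaluate-uniqueᵛ []       = []
      evaluate-uniqueᵛ (t ∷ ts) = evaluate-uniqueᵗ t ∷ evaluate-uniqueᵛ ts

theorem2 : ∀ {ℓ ℓ′ : Level} (L : Language ℓ) (Φ : Theory L) →
    Consistent Φ →
    IsModel (termStructure Φ) Φ →
    (N : Structure L ℓ′) → IsModel N Φ → Reduced N →
    (v : Structure.Evaluation N) →
    ∃! _≈ʰ_ λ (g : Homomorphism (termStructure Φ) N) →
      ∀ (x : ℕ) → Structure._≈_ N (Homomorphism.to g (var x)) (v x)
theorem2 L Φ _ _ N N⊨Φ reduced v =
  evaluate N⊨Φ reduced v ,
  (λ x → Setoid.refl (Structure.domain N)) ,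
  (λ {g} g-var → evaluate-uniqueᵗ g g-var)
  where open Semantics N
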